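{- There exists an absolute constant $c > 0$ such that the following holds for all integers $n \ge 1$, $u > n$, $s \ge 1$, $w \ge 1$ and $t$. If there is a non-adaptive static cell probe data structure for the dictionary problem that stores any set of $n$ key-value pairs $(x_i,y_i)\in[u]\times[u]$ (with distinct keys) using $s$ memory cells of $w$ bits each and answers every query using at most $t$ probes, then $$t \;\ge\; c\cdot \min\left\{\frac{n\lg(u/n)}{w},\ \frac{\lg(u/n)}{\lg\big(sw/(n\lg(u/n))\big)}\right\}.$$
   Context: Here $[m] = \{0,\dots,m-1\}$ and $\lg$ is the base-2 logarithm. Dictionary problem: the input is a set $X$ of $n$ key-value pairs from $[u]\times[u]$ such that each key $x$ occurs in at most one pair. On query $x\in[u]$, the data structure must return the value $y$ with $(x,y)\in X$, or report that no such $y$ exists. Cell probe model (static, deterministic): for each input $X$, the data structure stores a memory of $s$ cells with addresses $0,\dots,s-1$, each containing $w$ bits (an arbitrary function of $X$). A query $x$ is answered by probing (reading) cells; the answer must be correct for every input and every query. Computation is free, and the query time is the maximum number of cells probed. The data structure is non-adaptive if the set of addresses probed on query $x$ depends only on $x$ (not on $X$ or on the contents of cells); the answer is then a function of $x$ and the contents of the probed cells. -}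

module Defs where

open import Algebra.Bundles using (CommutativeRing)
import Algebra.Properties.CommutativeSemiring.Exp as Exp
open import Data.Bool.Base using (Bool; if_then_else_)
open import Data.Fin.Base using (Fin; combine)
open import Data.Fin.Subset using (Subset; _∈_; _∉_; ∣_∣)
open import Data.Integer.Base as ℤ using (ℤ; -[1+_]; _⊖_)
import Data.Integer.Properties as ℤ
open import Data.Integer.Solver using () renaming (module +-*-Solver to ℤ-Solver)
open import Data.Maybe.Base using (Maybe; just; nothing)
open import Data.Nat.Base as ℕ using (ℕ; zero; suc; NonZero)
open import Data.Nat.Coprimality as Coprime using (1-coprimeTo)
import Data.Nat.Properties as ℕ
open import Data.Product.Base using (Σ; ∃; ∃₂; _×_; _,_)
open import Data.Rational.Base as ℚ using (ℚ; mkℚ; 0ℚ; 1ℚ; ½; _+_; _*_; -_; _-_; _<_; _≤_)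
import Data.Rational.Properties as ℚ
import Data.Rational.Unnormalised.Base as ℚᵘ
import Data.Rational.Unnormalised.Properties as ℚᵘ
open import Data.Rational.Solver using (module +-*-Solver)
open import Data.Sum.Base using (_⊎_; inj₁; inj₂)
open import Data.Vec.Base using (Vec; zipWith)
open import Relation.Binary.Definitions using (tri<; tri≈; tri>)
open import Relation.Binary.PropositionalEquality
  using (_≡_; refl; sym; trans; cong; cong₂; subst; subst₂)
open import Relation.Nullary.Decidable.Core using (yes; no)
open import Relation.Nullary.Negation.Core using (¬_; contradiction)

open Exp (CommutativeRing.commutativeSemiring ℚ.+-*-commutativeRing)
  using (_^_; ^-homo-*; ^-assocʳ; ^-distrib-*)

fromℕ : ℕ → ℚ
fromℕ n = mkℚ (ℤ.+ n) 0 (Coprime.sym (1-coprimeTo n))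

module RationalLemmas where

  *-monoˡ-< : ∀ {p q r} → 0ℚ < r → p < q → p * r < q * r
  *-monoˡ-< {r = r} 0<r p<q = ℚ.*-monoˡ-<-pos r {{ℚ.positive 0<r}} p<q

  *-monoʳ-< : ∀ {p q r} → 0ℚ < r → p < q → r * p < r * q
  *-monoʳ-< {r = r} 0<r p<q = ℚ.*-monoʳ-<-pos r {{ℚ.positive 0<r}} p<q

  *-monoˡ-≤ : ∀ {p q r} → 0ℚ ≤ r → p ≤ q → p * r ≤ q * r
  *-monoˡ-≤ {r = r} 0≤r p≤q = ℚ.*-monoʳ-≤-nonNeg r {{ℚ.nonNegative 0≤r}} p≤q

  *-monoʳ-≤ : ∀ {p q r} → 0ℚ ≤ r → p ≤ q → r * p ≤ r * q
  *-monoʳ-≤ {r = r} 0≤r p≤q = ℚ.*-monoˡ-≤-nonNeg r {{ℚ.nonNegative 0≤r}} p≤q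

  *-cancelʳ-< : ∀ {p q r} → 0ℚ < r → p * r < q * r → p < q
  *-cancelʳ-< {r = r} 0<r = ℚ.*-cancelʳ-<-nonNeg r {{ℚ.nonNegative (ℚ.<⇒≤ 0<r)}}

  *-pos : ∀ {p q} → 0ℚ < p → 0ℚ < q → 0ℚ < p * q
  *-pos {p} {q} 0<p 0<q = subst (_< p * q) (ℚ.*-zeroˡ q) (*-monoˡ-< 0<q 0<p)

  *-nonNeg : ∀ {p q} → 0ℚ ≤ p → 0ℚ ≤ q → 0ℚ ≤ p * q
  *-nonNeg {p} {q} 0≤p 0≤q = subst (_≤ p * q) (ℚ.*-zeroˡ q) (*-monoˡ-≤ 0≤q 0≤p)

  *-mono-≤ : ∀ {p q r s} → 0ℚ ≤ p → 0ℚ ≤ s → p ≤ q → r ≤ s → p * r ≤ q * s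
  *-mono-≤ 0≤p 0≤s p≤q r≤s = ℚ.≤-trans (*-monoʳ-≤ 0≤p r≤s) (*-monoˡ-≤ 0≤s p≤q)

  *-mono-< : ∀ {p q r s} → 0ℚ < p → 0ℚ < s → p < q → r < s → p * r < q * s
  *-mono-< 0<p 0<s p<q r<s = ℚ.<-trans (*-monoʳ-< 0<p r<s) (*-monoˡ-< 0<s p<q)

  0<1 : 0ℚ < 1ℚ
  0<1 = ℚ.*<* (ℤ.+<+ ℕ.z<s)

  0≤1 : 0ℚ ≤ 1ℚ
  0≤1 = ℚ.<⇒≤ 0<1

  p<p+ε : ∀ p {ε} → 0ℚ < ε → p < p + ε
  p<p+ε p {ε} 0<ε = subst (_< p + ε) (ℚ.+-identityʳ p) (ℚ.+-monoʳ-< p 0<ε)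

  p<q⇒0<q-p : ∀ {p q} → p < q → 0ℚ < q - p
  p<q⇒0<q-p {p} {q} p<q = subst (_< q - p) (ℚ.+-inverseʳ p) (ℚ.+-monoˡ-< (- p) p<q)

  p+[q-p]≡q : ∀ p q → p + (q - p) ≡ q
  p+[q-p]≡q = solve 2 (λ p q → p :+ (q :- p) := q) refl
    where open +-*-Solver

  inv : (p : ℚ) → 0ℚ < p → ℚ
  inv p 0<p = ℚ.1/_ p {{ℚ.>-nonZero 0<p}}

  *-inv : ∀ p 0<p → p * inv p 0<p ≡ 1ℚ
  *-inv p 0<p = ℚ.*-inverseʳ p {{ℚ.>-nonZero 0<p}}

  inv-pos : ∀ p 0<p → 0ℚ < inv p 0<p
  inv-pos p 0<p = *-cancelʳ-< 0<p (subst₂ _<_ (sym (ℚ.*-zeroˡ p))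
    (trans (sym (*-inv p 0<p)) (ℚ.*-comm p _)) 0<1)

  fromℕ-mono-≤ : ∀ {m n} → m ℕ.≤ n → fromℕ m ≤ fromℕ n
  fromℕ-mono-≤ {m} {n} m≤n = ℚ.*≤*
    (subst₂ ℤ._≤_ (sym (ℤ.*-identityʳ (ℤ.+ m))) (sym (ℤ.*-identityʳ (ℤ.+ n))) (ℤ.+≤+ m≤n))

  fromℕ-mono-< : ∀ {m n} → m ℕ.< n → fromℕ m < fromℕ n
  fromℕ-mono-< {m} {n} m<n = ℚ.*<*
    (subst₂ ℤ._<_ (sym (ℤ.*-identityʳ (ℤ.+ m))) (sym (ℤ.*-identityʳ (ℤ.+ n))) (ℤ.+<+ m<n))

  fromℕ-suc : ∀ n → fromℕ (suc n) ≡ 1ℚ + fromℕ n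
  fromℕ-suc n = ℚ.toℚᵘ-injective (ℚᵘ.≃-sym
    (ℚᵘ.≃-trans (ℚ.toℚᵘ-homo-+ 1ℚ (fromℕ n))
      (ℚᵘ.*≡* (cong (λ i → i ℤ.* (ℤ.+ 1)) (cong (λ i → (ℤ.+ 1) ℤ.+ i) (ℤ.*-identityʳ (ℤ.+ n)))))))

  fromℕ-nonNeg : ∀ n → 0ℚ ≤ fromℕ n
  fromℕ-nonNeg n = fromℕ-mono-≤ ℕ.z≤n

  fromℕ-pos : ∀ n .{{_ : NonZero n}} → 0ℚ < fromℕ n
  fromℕ-pos n = fromℕ-mono-< (ℕ.>-nonZero⁻¹ n)

  bounded : ∀ p → ∃ λ n → p ≤ fromℕ n
  bounded p@(mkℚ i d-1 _) = ℤ.∣ i ∣ , ℚ.toℚᵘ-cancel-≤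
    (ℚᵘ.*≤*
      (ℤ.≤-trans (subst (λ j → j ℤ.≤ ℤ.+ ℤ.∣ i ∣) (sym (ℤ.*-identityʳ i)) (i≤∣i∣ i))
        (subst (λ j → ℤ.+ ℤ.∣ i ∣ ℤ.≤ j) (ℤ.pos-* ℤ.∣ i ∣ (suc d-1))
          (ℤ.+≤+ (ℕ.m≤m*n ℤ.∣ i ∣ (suc d-1))))))
    where
    i≤∣i∣ : ∀ i → i ℤ.≤ ℤ.+ ℤ.∣ i ∣
    i≤∣i∣ (ℤ.+ n)    = ℤ.≤-refl
    i≤∣i∣ -[1+ n ] = ℤ.-≤+

  archimedean : ∀ p {ε} → 0ℚ < ε → ∃ λ n → p ≤ fromℕ n * ε
  archimedean p {ε} 0<ε with bounded (p * inv ε 0<ε)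
  ... | n , h = n , subst (_≤ fromℕ n * ε)
    (trans (ℚ.*-assoc p _ ε)
      (trans (cong (p *_) (trans (ℚ.*-comm _ ε) (*-inv ε 0<ε))) (ℚ.*-identityʳ p)))
    (*-monoˡ-≤ (ℚ.<⇒≤ 0<ε) h)

  2ℚ : ℚ
  2ℚ = fromℕ 2

  0<2 : 0ℚ < 2ℚ
  0<2 = fromℕ-pos 2

  ^-pos : ∀ {p} → 0ℚ < p → ∀ n → 0ℚ < p ^ n
  ^-pos 0<p zero    = 0<1
  ^-pos 0<p (suc n) = *-pos 0<p (^-pos 0<p n)

  ^-monoˡ-≤ : ∀ {p q} → 0ℚ < p → p ≤ q → ∀ n → p ^ n ≤ q ^ n
  ^-monoˡ-≤ 0<p p≤q zero    = ℚ.≤-refl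
  ^-monoˡ-≤ 0<p p≤q (suc n) = *-mono-≤ (ℚ.<⇒≤ 0<p)
    (ℚ.<⇒≤ (^-pos (ℚ.<-≤-trans 0<p p≤q) n)) p≤q (^-monoˡ-≤ 0<p p≤q n)

  ^-monoˡ-< : ∀ {p q} → 0ℚ < p → p < q → ∀ n .{{_ : NonZero n}} → p ^ n < q ^ n
  ^-monoˡ-< 0<p p<q (suc n) = ℚ.<-≤-trans (*-monoˡ-< (^-pos 0<p n) p<q)
    (*-monoʳ-≤ (ℚ.<⇒≤ (ℚ.<-trans 0<p p<q)) (^-monoˡ-≤ 0<p (ℚ.<⇒≤ p<q) n))

  1≤2^ : ∀ n → 1ℚ ≤ 2ℚ ^ n
  1≤2^ zero    = ℚ.≤-refl
  1≤2^ (suc n) = *-mono-≤ 0≤1 (ℚ.<⇒≤ (^-pos 0<2 n)) (fromℕ-mono-≤ {1} {2} (ℕ.s≤s ℕ.z≤n)) (1≤2^ n)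

  2^-mono-≤ : ∀ {m n} → m ℕ.≤ n → 2ℚ ^ m ≤ 2ℚ ^ n
  2^-mono-≤ {n = n} ℕ.z≤n = 1≤2^ n
  2^-mono-≤ (ℕ.s≤s m≤n)   = *-monoʳ-≤ (ℚ.<⇒≤ 0<2) (2^-mono-≤ m≤n)

  2^-cancel-< : ∀ {m n} → 2ℚ ^ m < 2ℚ ^ n → m ℕ.< n
  2^-cancel-< {m} {n} h with m ℕ.<? n
  ... | yes m<n = m<n
  ... | no  m≮n = contradiction (ℚ.<-≤-trans h (2^-mono-≤ (ℕ.≮⇒≥ m≮n))) (ℚ.<-irrefl refl)

  n≤2^n : ∀ n → fromℕ n ≤ 2ℚ ^ n
  n≤2^n zero    = 0≤1
  n≤2^n (suc n) = subst₂ _≤_ (sym (fromℕ-suc n)) (sym (2* (2ℚ ^ n)))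
    (ℚ.+-mono-≤ (1≤2^ n) (n≤2^n n))
    where
    open +-*-Solver
    2* : ∀ p → 2ℚ * p ≡ p + p
    2* = solve 1 (λ p → con 2ℚ :* p := p :+ p) refl

  bernoulli : ∀ {ε} → 0ℚ ≤ ε → ∀ n → 1ℚ + fromℕ n * ε ≤ (1ℚ + ε) ^ n
  bernoulli {ε} 0≤ε zero    = ℚ.≤-reflexive (trans (cong (1ℚ +_) (ℚ.*-zeroˡ ε)) (ℚ.+-identityʳ 1ℚ))
  bernoulli {ε} 0≤ε (suc n) = ℚ.≤-trans
    (subst₂ _≤_ (trans (ℚ.+-identityʳ _) (cong (λ k → 1ℚ + k * ε) (sym (fromℕ-suc n))))
      (sym (expand ε (fromℕ n)))
      (ℚ.+-monoʳ-≤ (1ℚ + (1ℚ + fromℕ n) * ε) (*-nonNeg (*-nonNeg (fromℕ-nonNeg n) 0≤ε) 0≤ε)))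
    (*-monoʳ-≤ (ℚ.≤-trans 0≤1 (subst (_≤ 1ℚ + ε) (ℚ.+-identityʳ 1ℚ) (ℚ.+-monoʳ-≤ 1ℚ 0≤ε)))
      (bernoulli 0≤ε n))
    where
    open +-*-Solver
    expand : ∀ ε k → (1ℚ + ε) * (1ℚ + k * ε) ≡ (1ℚ + (1ℚ + k) * ε) + k * ε * ε
    expand = solve 2 (λ ε k → (con 1ℚ :+ ε) :* (con 1ℚ :+ k :* ε)
                            := (con 1ℚ :+ (con 1ℚ :+ k) :* ε) :+ k :* ε :* ε) refl

  -- 2ⁿ − 1
  mersenne : ℕ → ℚ
  mersenne zero    = 0ℚ
  mersenne (suc n) = (mersenne n + mersenne n) + 1ℚ

  mersenne-nonNeg : ∀ n → 0ℚ ≤ mersenne n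
  mersenne-nonNeg zero    = ℚ.≤-refl
  mersenne-nonNeg (suc n) = ℚ.+-mono-≤ (ℚ.+-mono-≤ (mersenne-nonNeg n) (mersenne-nonNeg n)) 0≤1

  ^-upper : ∀ {ε} → 0ℚ ≤ ε → ε ≤ 1ℚ → ∀ n → (1ℚ + ε) ^ n ≤ 1ℚ + mersenne n * ε
  ^-upper {ε} 0≤ε ε≤1 zero    = ℚ.≤-reflexive (sym (trans (cong (1ℚ +_) (ℚ.*-zeroˡ ε)) (ℚ.+-identityʳ 1ℚ)))
  ^-upper {ε} 0≤ε ε≤1 (suc n) = ℚ.≤-trans
    (*-monoʳ-≤ (ℚ.≤-trans 0≤1 (subst (_≤ 1ℚ + ε) (ℚ.+-identityʳ 1ℚ) (ℚ.+-monoʳ-≤ 1ℚ 0≤ε)))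
      (^-upper 0≤ε ε≤1 n))
    (subst₂ _≤_ (sym (expand ε c)) (collect ε c)
      (ℚ.+-monoʳ-≤ (1ℚ + ε + c * ε) (*-monoʳ-≤ (*-nonNeg (mersenne-nonNeg n) 0≤ε) ε≤1)))
    where
    open +-*-Solver
    c = mersenne n
    expand : ∀ ε c → (1ℚ + ε) * (1ℚ + c * ε) ≡ (1ℚ + ε + c * ε) + c * ε * ε
    expand = solve 2 (λ ε c → (con 1ℚ :+ ε) :* (con 1ℚ :+ c :* ε)
                            := (con 1ℚ :+ ε :+ c :* ε) :+ c :* ε :* ε) refl
    collect : ∀ ε c → (1ℚ + ε + c * ε) + c * ε * 1ℚ ≡ 1ℚ + ((c + c) + 1ℚ) * ε
    collect = solve 2 (λ ε c → (con 1ℚ :+ ε :+ c :* ε) :+ c :* ε :* con 1ℚ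
                             := con 1ℚ :+ ((c :+ c) :+ con 1ℚ) :* ε) refl

  approx-root-of-2 : ∀ n → ∃ λ g → 1ℚ < g × g ^ n ≤ 2ℚ
  approx-root-of-2 n = 1ℚ + ε , p<p+ε 1ℚ 0<ε ,
    ℚ.≤-trans (^-upper (ℚ.<⇒≤ 0<ε) ε≤1 n) (ℚ.+-monoʳ-≤ 1ℚ cε≤1)
    where
    open +-*-Solver
    c   = mersenne n
    0<d = ℚ.<-≤-trans 0<1 (subst (_≤ 1ℚ + c) (ℚ.+-identityʳ 1ℚ) (ℚ.+-monoʳ-≤ 1ℚ (mersenne-nonNeg n)))
    ε   = inv (1ℚ + c) 0<d
    0<ε = inv-pos (1ℚ + c) 0<d
    sum : ε + c * ε ≡ 1ℚ
    sum = trans (solve 2 (λ ε c → ε :+ c :* ε := (con 1ℚ :+ c) :* ε) refl ε c) (*-inv (1ℚ + c) 0<d)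
    ε≤1 : ε ≤ 1ℚ
    ε≤1 = subst₂ _≤_ (ℚ.+-identityʳ ε) sum
      (ℚ.+-monoʳ-≤ ε (*-nonNeg (mersenne-nonNeg n) (ℚ.<⇒≤ 0<ε)))
    cε≤1 : c * ε ≤ 1ℚ
    cε≤1 = subst₂ _≤_ (ℚ.+-identityˡ (c * ε)) sum (ℚ.+-monoˡ-≤ (c * ε) (ℚ.<⇒≤ 0<ε))

  /-mono-< : ∀ i j d e .{{_ : NonZero d}} .{{_ : NonZero e}} →
             i ℤ.* ℤ.+ e ℤ.< j ℤ.* ℤ.+ d → i ℚ./ d < j ℚ./ e
  /-mono-< i j (suc d) (suc e) h = ℚ.toℚᵘ-cancel-<
    (ℚᵘ.<-respˡ-≃ (ℚᵘ.≃-sym (ℚ.toℚᵘ-fromℚᵘ (ℚᵘ.mkℚᵘ i d)))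
      (ℚᵘ.<-respʳ-≃ (ℚᵘ.≃-sym (ℚ.toℚᵘ-fromℚᵘ (ℚᵘ.mkℚᵘ j e))) (ℚᵘ.*<* h)))

  ⊖-surjective : ∀ k → ∃₂ λ m n → m ⊖ n ≡ k
  ⊖-surjective (ℤ.+ n)  = n , 0 , refl
  ⊖-surjective -[1+ n ] = 0 , suc n , refl

  suc-⊖ : ∀ m n → suc m ⊖ n ≡ ℤ.suc (m ⊖ n)
  suc-⊖ m n = trans (sym (ℤ.m-n≡m⊖n (suc m) n))
    (trans (ℤ.+-assoc (ℤ.+ 1) (ℤ.+ m) (ℤ.- (ℤ.+ n))) (cong ℤ.suc (ℤ.m-n≡m⊖n m n)))

  ⊖/-mono-< : ∀ m n m′ n′ {b b′} .{{_ : NonZero b}} .{{_ : NonZero b′}} →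
              m ℕ.* b′ ℕ.+ n′ ℕ.* b ℕ.< n ℕ.* b′ ℕ.+ m′ ℕ.* b →
              (m ⊖ n) ℚ./ b < (m′ ⊖ n′) ℚ./ b′
  ⊖/-mono-< m n m′ n′ {b} {b′} h = /-mono-< (m ⊖ n) (m′ ⊖ n′) b b′
    (subst₂ ℤ._<_
      (trans (eqˡ (ℤ.+ m) (ℤ.+ n) (ℤ.+ n′) (ℤ.+ b) (ℤ.+ b′)) (cong (λ k → k ℤ.* ℤ.+ b′) (ℤ.m-n≡m⊖n m n)))
      (trans (eqʳ (ℤ.+ n) (ℤ.+ m′) (ℤ.+ n′) (ℤ.+ b) (ℤ.+ b′)) (cong (λ k → k ℤ.* ℤ.+ b) (ℤ.m-n≡m⊖n m′ n′)))
      (ℤ.+-monoˡ-< (ℤ.- (ℤ.+ n ℤ.* ℤ.+ b′ ℤ.+ ℤ.+ n′ ℤ.* ℤ.+ b))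
        (subst₂ ℤ._<_ (cast m b′ n′ b) (cast n b′ m′ b) (ℤ.+<+ h))))
    where
    open ℤ-Solver
    cast : ∀ x y z w → ℤ.+ (x ℕ.* y ℕ.+ z ℕ.* w) ≡ (ℤ.+ x) ℤ.* (ℤ.+ y) ℤ.+ (ℤ.+ z) ℤ.* (ℤ.+ w)
    cast x y z w = trans (ℤ.pos-+ (x ℕ.* y) (z ℕ.* w)) (cong₂ ℤ._+_ (ℤ.pos-* x y) (ℤ.pos-* z w))
    eqˡ : ∀ m n n′ b b′ →
          (m ℤ.* b′ ℤ.+ n′ ℤ.* b) ℤ.- (n ℤ.* b′ ℤ.+ n′ ℤ.* b) ≡ (m ℤ.- n) ℤ.* b′
    eqˡ = solve 5 (λ m n n′ b b′ →
      (m :* b′ :+ n′ :* b) :- (n :* b′ :+ n′ :* b) := (m :- n) :* b′) refl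
    eqʳ : ∀ n m′ n′ b b′ →
          (n ℤ.* b′ ℤ.+ m′ ℤ.* b) ℤ.- (n ℤ.* b′ ℤ.+ n′ ℤ.* b) ≡ (m′ ℤ.- n′) ℤ.* b
    eqʳ = solve 5 (λ n m′ n′ b b′ →
      (n :* b′ :+ m′ :* b) :- (n :* b′ :+ n′ :* b) := (m′ :- n′) :* b) refl

  between : ∀ {i j d e} .{{_ : NonZero d}} .{{_ : NonZero e}} →
            let b = 3 ℕ.* (d ℕ.* e)
                k = ℤ.+ 3 ℤ.* (i ℤ.* ℤ.+ e) ℤ.+ ℤ.+ 1
            in i ℤ.* ℤ.+ e ℤ.< j ℤ.* ℤ.+ d →
               (i ℤ.* ℤ.+ b ℤ.< k ℤ.* ℤ.+ d) × (ℤ.suc k ℤ.* ℤ.+ e ℤ.< j ℤ.* ℤ.+ b)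
  between {i} {j} {d@(suc _)} {e@(suc _)} h =
    subst₂ ℤ._<_ (trans (eq₁ i D E) (cong (i ℤ.*_) (sym castB))) refl
      (ℤ.*-monoʳ-<-pos D (i<i+1 (ℤ.+ 3 ℤ.* (i ℤ.* E)))) ,
    subst₂ ℤ._<_ (eq₃ i E) (trans (eq₄ j D E) (cong (j ℤ.*_) (sym castB)))
      (ℤ.<-≤-trans (ℤ.*-monoʳ-<-pos E (i<i+1 (ℤ.+ 3 ℤ.* (i ℤ.* E) ℤ.+ ℤ.+ 2)))
        (subst (ℤ._≤ (ℤ.+ 3 ℤ.* (j ℤ.* D)) ℤ.* E) (eq₅ i E)
          (ℤ.*-monoʳ-≤-nonNeg E (ℤ.*-monoˡ-≤-nonNeg (ℤ.+ 3) (ℤ.i<j⇒suc[i]≤j h)))))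
    where
    open ℤ-Solver
    D = ℤ.+ d
    E = ℤ.+ e
    castB : ℤ.+ (3 ℕ.* (d ℕ.* e)) ≡ ℤ.+ 3 ℤ.* (D ℤ.* E)
    castB = trans (ℤ.pos-* 3 (d ℕ.* e)) (cong (ℤ.+ 3 ℤ.*_) (ℤ.pos-* d e))
    i<i+1 : ∀ i → i ℤ.< i ℤ.+ ℤ.+ 1
    i<i+1 i = subst (ℤ._< i ℤ.+ ℤ.+ 1) (ℤ.+-identityʳ i) (ℤ.+-monoʳ-< i (ℤ.+<+ ℕ.z<s))
    eq₁ : ∀ i D E → (ℤ.+ 3 ℤ.* (i ℤ.* E)) ℤ.* D ≡ i ℤ.* (ℤ.+ 3 ℤ.* (D ℤ.* E))
    eq₁ = solve 3 (λ i D E → (con (ℤ.+ 3) :* (i :* E)) :* D := i :* (con (ℤ.+ 3) :* (D :* E))) refl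
    eq₃ : ∀ i E → (ℤ.+ 3 ℤ.* (i ℤ.* E) ℤ.+ ℤ.+ 2) ℤ.* E ≡ ℤ.suc (ℤ.+ 3 ℤ.* (i ℤ.* E) ℤ.+ ℤ.+ 1) ℤ.* E
    eq₃ = solve 2 (λ i E → (con (ℤ.+ 3) :* (i :* E) :+ con (ℤ.+ 2)) :* E
      := (con (ℤ.+ 1) :+ (con (ℤ.+ 3) :* (i :* E) :+ con (ℤ.+ 1))) :* E) refl
    eq₄ : ∀ j D E → (ℤ.+ 3 ℤ.* (j ℤ.* D)) ℤ.* E ≡ j ℤ.* (ℤ.+ 3 ℤ.* (D ℤ.* E))
    eq₄ = solve 3 (λ j D E → (con (ℤ.+ 3) :* (j :* D)) :* E := j :* (con (ℤ.+ 3) :* (D :* E))) refl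
    eq₅ : ∀ i E → (ℤ.+ 3 ℤ.* ℤ.suc (i ℤ.* E)) ℤ.* E ≡ ((ℤ.+ 3 ℤ.* (i ℤ.* E) ℤ.+ ℤ.+ 2) ℤ.+ ℤ.+ 1) ℤ.* E
    eq₅ = solve 2 (λ i E → (con (ℤ.+ 3) :* (con (ℤ.+ 1) :+ i :* E)) :* E
      := ((con (ℤ.+ 3) :* (i :* E) :+ con (ℤ.+ 2)) :+ con (ℤ.+ 1)) :* E) refl

  consecutive : ∀ {p q} → p < q → ∃₂ λ m n → ∃ λ b → Σ (NonZero b) λ b≢0 →
                (p < ℚ._/_ (m ⊖ n) b {{b≢0}}) × (ℚ._/_ (suc m ⊖ n) b {{b≢0}} < q)
  consecutive {p@(mkℚ i d _)} {q@(mkℚ j e _)} (ℚ.*<* h) =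
    let lo , hi      = between {i} {j} {suc d} {suc e} h
        m , n , eq   = ⊖-surjective k
    in m , n , b , _ ,
       subst₂ _<_ (ℚ.fromℚᵘ-toℚᵘ p) (cong (ℚ._/ b) (sym eq)) (/-mono-< i k (suc d) b lo) ,
       subst₂ _<_ (cong (ℚ._/ b) (sym (trans (suc-⊖ m n) (cong ℤ.suc eq)))) (ℚ.fromℚᵘ-toℚᵘ q)
         (/-mono-< (ℤ.suc k) j b (suc e) hi)
    where
    b = 3 ℕ.* (suc d ℕ.* suc e)
    k = ℤ.+ 3 ℤ.* (i ℤ.* ℤ.+ suc e) ℤ.+ ℤ.+ 1

open RationalLemmas

-- Two-sided, located Dedekind cuts: lower q means q < x and upper q means x < q.
record ℝ : Set₁ where
  field
    lower upper     : ℚ → Set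
    lower-inhabited : ∃ lower
    upper-inhabited : ∃ upper
    lower-closed    : ∀ {p q} → p < q → lower q → lower p
    upper-closed    : ∀ {p q} → p < q → upper p → upper q
    lower-open      : ∀ {p} → lower p → ∃ λ q → p < q × lower q
    upper-open      : ∀ {q} → upper q → ∃ λ p → p < q × upper p
    disjoint        : ∀ {q} → lower q → ¬ upper q
    located         : ∀ {p q} → p < q → lower p ⊎ upper q

  lower<upper : ∀ {p q} → lower p → upper q → p < q
  lower<upper {p} {q} lp uq with ℚ.<-cmp p q
  ... | tri< p<q _ _ = p<q
  ... | tri≈ _ refl _ = contradiction uq (disjoint lp)
  ... | tri> _ _ q<p = contradiction uq (disjoint (lower-closed q<p lp))

  lower-closed-≤ : ∀ {p q} → p ≤ q → lower q → lower p
  lower-closed-≤ {p} {q} p≤q lq with lower-open lq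
  ... | r , q<r , lr = lower-closed (ℚ.≤-<-trans p≤q q<r) lr

  approx : ∀ {l} → lower l → ∀ {η} → 0ℚ < η → ∃ λ a → l ≤ a × lower a × upper (a + (η + η))
  approx {l} ll {η} 0<η with upper-inhabited
  ... | u , uu with archimedean (u - l) 0<η
  ... | k , h = search k l ll ℚ.≤-refl
        (subst (_≤ l + fromℕ k * η) (p+[q-p]≡q l u) (ℚ.+-monoʳ-≤ l h))
    where
    open +-*-Solver
    step : ∀ a k η → a + (1ℚ + k) * η ≡ (a + η) + k * η
    step = solve 3 (λ a k η → a :+ (con 1ℚ :+ k) :* η := (a :+ η) :+ k :* η) refl

    search : ∀ k a → lower a → l ≤ a → u ≤ a + fromℕ k * η →
             ∃ λ a → l ≤ a × lower a × upper (a + (η + η))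
    search zero a la l≤a h = contradiction
      (ℚ.<-≤-trans (lower<upper la uu)
        (subst (u ≤_) (trans (cong (λ x → a + x) (ℚ.*-zeroˡ η)) (ℚ.+-identityʳ a)) h))
      (ℚ.<-irrefl refl)
    search (suc k) a la l≤a h
      with located (ℚ.+-monoʳ-< a (p<p+ε η 0<η))
    ... | inj₂ ua = a , l≤a , la , ua
    ... | inj₁ la+η = search k (a + η) la+η
      (ℚ.≤-trans l≤a (ℚ.<⇒≤ (p<p+ε a 0<η)))
      (subst (u ≤_) (trans (cong (λ x → a + x * η) (fromℕ-suc k)) (step a (fromℕ k) η)) h)

open ℝ

infix 4 _≤ℝ_ _<ℝ_

_≤ℝ_ : ℝ → ℝ → Set
x ≤ℝ y = ∀ q → lower x q → lower y q

_<ℝ_ : ℝ → ℝ → Set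
x <ℝ y = ∃ λ q → upper x q × lower y q

fromℚ : ℚ → ℝ
fromℚ r = record
  { lower           = _< r
  ; upper           = r <_
  ; lower-inhabited = r - 1ℚ , subst (r - 1ℚ <_) (r-1+1 r) (p<p+ε (r - 1ℚ) 0<1)
  ; upper-inhabited = r + 1ℚ , p<p+ε r 0<1
  ; lower-closed    = ℚ.<-trans
  ; upper-closed    = λ p<q r<p → ℚ.<-trans r<p p<q
  ; lower-open      = λ p<r → ℚ.<-dense p<r
  ; upper-open      = λ r<q → let p , r<p , p<q = ℚ.<-dense r<q in p , p<q , r<p
  ; disjoint        = ℚ.<-asym
  ; located         = loc
  }
  where
  open +-*-Solver
  r-1+1 : ∀ r → r - 1ℚ + 1ℚ ≡ r
  r-1+1 = solve 1 (λ r → r :- con 1ℚ :+ con 1ℚ := r) refl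
  loc : ∀ {p q} → p < q → p < r ⊎ r < q
  loc {p} {q} p<q with p ℚ.<? r
  ... | yes p<r = inj₁ p<r
  ... | no  p≮r = inj₂ (ℚ.≤-<-trans (ℚ.≮⇒≥ p≮r) p<q)

min : ℝ → ℝ → ℝ
min x y = record
  { lower           = λ q → lower x q × lower y q
  ; upper           = λ q → upper x q ⊎ upper y q
  ; lower-inhabited = inh
  ; upper-inhabited = let q , h = upper-inhabited x in q , inj₁ h
  ; lower-closed    = λ p<q (h , k) → lower-closed x p<q h , lower-closed y p<q k
  ; upper-closed    = λ { p<q (inj₁ h) → inj₁ (upper-closed x p<q h)
                        ; p<q (inj₂ h) → inj₂ (upper-closed y p<q h) }
  ; lower-open      = λ (h , k) → opn h k
  ; upper-open      = λ { (inj₁ h) → let p , p<q , h′ = upper-open x h in p , p<q , inj₁ h′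
                        ; (inj₂ h) → let p , p<q , h′ = upper-open y h in p , p<q , inj₂ h′ }
  ; disjoint        = λ { (h , k) (inj₁ h′) → disjoint x h h′
                        ; (h , k) (inj₂ k′) → disjoint y k k′ }
  ; located         = loc
  }
  where
  inh : ∃ λ q → lower x q × lower y q
  inh with lower-inhabited x | lower-inhabited y
  ... | p , h | q , k with ℚ.≤-total p q
  ... | inj₁ p≤q = p , h , lower-closed-≤ y p≤q k
  ... | inj₂ q≤p = q , lower-closed-≤ x q≤p h , k
  opn : ∀ {p} → lower x p → lower y p → ∃ λ q → p < q × lower x q × lower y q
  opn h k with lower-open x h | lower-open y k
  ... | q , p<q , h′ | r , p<r , k′ with ℚ.≤-total q r
  ... | inj₁ q≤r = q , p<q , h′ , lower-closed-≤ y q≤r k′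
  ... | inj₂ r≤q = r , p<r , lower-closed-≤ x r≤q h′ , k′
  loc : ∀ {p q} → p < q → lower x p × lower y p ⊎ upper x q ⊎ upper y q
  loc p<q with located x p<q | located y p<q
  ... | inj₁ h | inj₁ k = inj₁ (h , k)
  ... | inj₂ h | _      = inj₂ (inj₁ h)
  ... | inj₁ _ | inj₂ k = inj₂ (inj₂ k)

ι : ℕ → ℝ
ι n = fromℚ (fromℕ n)

record ℝ⁺ : Set₁ where
  constructor _,⁺_
  field
    real     : ℝ
    positive : lower real 0ℚ

open ℝ⁺

infix 4 _<⁺_

_<⁺_ : ℝ⁺ → ℝ⁺ → Set
x <⁺ y = real x <ℝ real y

ι⁺ : (n : ℕ) → 0 ℕ.< n → ℝ⁺
ι⁺ n 0<n = ι n ,⁺ fromℕ-mono-< 0<n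

min⁺ : ℝ⁺ → ℝ⁺ → ℝ⁺
min⁺ x y = min (real x) (real y) ,⁺ (positive x , positive y)

module PositiveLemmas (x : ℝ⁺) where

  lower-pos : ∃ λ a → 0ℚ < a × lower (real x) a
  lower-pos = lower-open (real x) (positive x)

  upper⇒pos : ∀ {a} → upper (real x) a → 0ℚ < a
  upper⇒pos = lower<upper (real x) (positive x)

  approx⁺ : ∀ {p q} → 0ℚ < p → p < q →
            ∃₂ λ a a′ → 0ℚ < a × lower (real x) a × upper (real x) a′ × p * a′ < q * a
  approx⁺ {p} {q} 0<p p<q =
    let l , 0<l , ll       = lower-pos
        m , p<m , m<q      = ℚ.<-dense p<q
        0<p⁻¹              = inv-pos p 0<p
        δ                  = (m - p) * inv p 0<p * l
        0<δ                = *-pos (*-pos (p<q⇒0<q-p p<m) 0<p⁻¹) 0<l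
        a , l≤a , la , ua′ = approx (real x) ll (*-pos {½} (ℚ.*<* (ℤ.+<+ ℕ.z<s)) 0<δ)
        0<a                = ℚ.<-≤-trans 0<l l≤a
        bound              = ℚ.≤-<-trans
          (ℚ.+-monoʳ-≤ (p * a) (*-monoʳ-≤ (ℚ.<⇒≤ (p<q⇒0<q-p p<m)) l≤a))
          (subst (_< q * a) (split p m a) (*-monoˡ-< 0<a m<q))
    in a , a + (½ * δ + ½ * δ) , 0<a , la , ua′ ,
       subst (_< q * a) (sym (expand p m (inv p 0<p) l a (*-inv p 0<p))) bound
    where
    open +-*-Solver
    split : ∀ p m a → m * a ≡ p * a + (m - p) * a
    split = solve 3 (λ p m a → m :* a := p :* a :+ (m :- p) :* a) refl
    expand : ∀ p m i l a → p * i ≡ 1ℚ →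
             p * (a + (½ * ((m - p) * i * l) + ½ * ((m - p) * i * l))) ≡ p * a + (m - p) * l
    expand p m i l a pi≡1 = trans
      (solve 5 (λ p m i l a →
         p :* (a :+ (con ½ :* ((m :- p) :* i :* l) :+ con ½ :* ((m :- p) :* i :* l)))
         := p :* a :+ (m :- p) :* l :* (p :* i)) refl p m i l a)
      (cong (λ z → p * a + z) (trans (cong ((m - p) * l *_) pi≡1) (ℚ.*-identityʳ _)))

open PositiveLemmas

infixl 7 _*⁺_

_*⁺_ : ℝ⁺ → ℝ⁺ → ℝ⁺
x *⁺ y = record
  { lower           = λ q → ∃₂ λ a b →
                      0ℚ < a × 0ℚ < b × lower (real x) a × lower (real y) b × q < a * b
  ; upper           = λ q → ∃₂ λ a b → upper (real x) a × upper (real y) b × a * b < q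
  ; lower-inhabited = 0ℚ , pos
  ; upper-inhabited = let a , ua = upper-inhabited (real x)
                          b , ub = upper-inhabited (real y)
                      in a * b + 1ℚ , a , b , ua , ub , p<p+ε (a * b) 0<1
  ; lower-closed    = λ { p<q (a , b , 0<a , 0<b , la , lb , q<ab) →
                          a , b , 0<a , 0<b , la , lb , ℚ.<-trans p<q q<ab }
  ; upper-closed    = λ { p<q (a , b , ua , ub , ab<p) → a , b , ua , ub , ℚ.<-trans ab<p p<q }
  ; lower-open      = λ { (a , b , 0<a , 0<b , la , lb , p<ab) →
                          let q , p<q , q<ab = ℚ.<-dense p<ab
                          in q , p<q , a , b , 0<a , 0<b , la , lb , q<ab }
  ; upper-open      = λ { (a , b , ua , ub , ab<q) →
                          let p , ab<p , p<q = ℚ.<-dense ab<q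
                          in p , p<q , a , b , ua , ub , ab<p }
  ; disjoint        = λ { (a , b , 0<a , 0<b , la , lb , q<ab) (c , d , uc , ud , cd<q) →
                          ℚ.<-asym (ℚ.<-trans q<ab (*-mono-< 0<a (upper⇒pos y ud)
                            (lower<upper (real x) la uc) (lower<upper (real y) lb ud))) cd<q }
  ; located         = loc
  } ,⁺ pos
  where
  Lower Upper : ℚ → Set
  Lower q = ∃₂ λ a b → 0ℚ < a × 0ℚ < b × lower (real x) a × lower (real y) b × q < a * b
  Upper q = ∃₂ λ a b → upper (real x) a × upper (real y) b × a * b < q

  pos : Lower 0ℚ
  pos = let a , 0<a , la = lower-pos x
            b , 0<b , lb = lower-pos y
        in a , b , 0<a , 0<b , la , lb , *-pos 0<a 0<b

  swap₁ : ∀ p b′ i i′ → p * b′ * (i * i′) ≡ p * i * (b′ * i′)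
  swap₁ = solve 4 (λ p b′ i i′ → p :* b′ :* (i :* i′) := p :* i :* (b′ :* i′)) refl
    where open +-*-Solver
  swap₂ : ∀ q b i i′ → q * b * (i * i′) ≡ q * i′ * (b * i)
  swap₂ = solve 4 (λ q b i i′ → q :* b :* (i :* i′) := q :* i′ :* (b :* i)) refl
    where open +-*-Solver

  cancel : ∀ p b i → b * i ≡ 1ℚ → p * i * b ≡ p
  cancel p b i bi≡1 = trans (ℚ.*-assoc p i b)
    (trans (cong (p *_) (trans (ℚ.*-comm i b) bi≡1)) (ℚ.*-identityʳ p))

  cross : ∀ {p q b b′} i i′ → 0ℚ < i → 0ℚ < i′ → b * i ≡ 1ℚ → b′ * i′ ≡ 1ℚ →
          p * b′ < q * b → p * i < q * i′
  cross {p} {q} {b} {b′} i i′ 0<i 0<i′ bi≡1 b′i′≡1 h = subst₂ _<_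
    (trans (swap₁ p b′ i i′) (trans (cong (p * i *_) b′i′≡1) (ℚ.*-identityʳ _)))
    (trans (swap₂ q b i i′) (trans (cong (q * i′ *_) bi≡1) (ℚ.*-identityʳ _)))
    (*-monoˡ-< (*-pos 0<i 0<i′) h)

  fin : ∀ {p q b b′} i i′ → 0ℚ < p → 0ℚ < b → 0ℚ < i → b * i ≡ 1ℚ → b′ * i′ ≡ 1ℚ →
        lower (real y) b → upper (real y) b′ →
        lower (real x) (p * i) ⊎ upper (real x) (q * i′) → Lower p ⊎ Upper q
  fin {p} {q} {b} {b′} i i′ 0<p 0<b 0<i bi≡1 b′i′≡1 lb ub′ (inj₁ l) =
    let a , p/b<a , la = lower-open (real x) l in inj₁
      (a , b , ℚ.<-trans (*-pos 0<p 0<i) p/b<a , 0<b , la , lb ,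
       subst (_< a * b) (cancel p b i bi≡1) (*-monoˡ-< 0<b p/b<a))
  fin {p} {q} {b} {b′} i i′ 0<p 0<b 0<i bi≡1 b′i′≡1 lb ub′ (inj₂ u) =
    let a , a<q/b′ , ua = upper-open (real x) u in inj₂
      (a , b′ , ua , ub′ , subst (a * b′ <_) (cancel q b′ i′ b′i′≡1) (*-monoˡ-< (upper⇒pos y ub′) a<q/b′))

  loc : ∀ {p q} → p < q → Lower p ⊎ Upper q
  loc {p} {q} p<q with 0ℚ ℚ.<? p
  ... | no 0≮p = let a , b , 0<a , 0<b , la , lb , 0<ab = pos
                 in inj₁ (a , b , 0<a , 0<b , la , lb , ℚ.≤-<-trans (ℚ.≮⇒≥ 0≮p) 0<ab)
  ... | yes 0<p =
    let b , b′ , 0<b , lb , ub′ , pb′<qb = approx⁺ y 0<p p<q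
        0<b′ = upper⇒pos y ub′
        i    = inv b 0<b
        i′   = inv b′ 0<b′
        0<i  = inv-pos b 0<b
        e    = *-inv b 0<b
        e′   = *-inv b′ 0<b′
    in fin {b = b} {b′} i i′ 0<p 0<b 0<i e e′ lb ub′
         (located (real x) (cross {p} {q} {b} {b′} i i′ 0<i (inv-pos b′ 0<b′) e e′ pb′<qb))

recip : ℝ⁺ → ℝ⁺
recip x = record
  { lower           = λ q → ∃ λ a → upper (real x) a × q * a < 1ℚ
  ; upper           = λ q → ∃ λ a → 0ℚ < a × lower (real x) a × 1ℚ < q * a
  ; lower-inhabited = 0ℚ , pos
  ; upper-inhabited = inh
  ; lower-closed    = λ { p<q (a , ua , qa<1) →
                          a , ua , ℚ.<-trans (*-monoˡ-< (upper⇒pos x ua) p<q) qa<1 }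
  ; upper-closed    = λ { p<q (a , 0<a , la , 1<pa) →
                          a , 0<a , la , ℚ.<-trans 1<pa (*-monoˡ-< 0<a p<q) }
  ; lower-open      = lopen
  ; upper-open      = uopen
  ; disjoint        = λ {q} → dis {q}
  ; located         = loc
  } ,⁺ pos
  where
  Lower Upper : ℚ → Set
  Lower q = ∃ λ a → upper (real x) a × q * a < 1ℚ
  Upper q = ∃ λ a → 0ℚ < a × lower (real x) a × 1ℚ < q * a

  expand : ∀ a i → (i + 1ℚ) * a ≡ a * i + a
  expand = solve 2 (λ a i → (i :+ con 1ℚ) :* a := a :* i :+ a) refl
    where open +-*-Solver

  cancel : ∀ p b i → b * i ≡ 1ℚ → p * i * b ≡ p
  cancel p b i bi≡1 = trans (ℚ.*-assoc p i b)
    (trans (cong (p *_) (trans (ℚ.*-comm i b) bi≡1)) (ℚ.*-identityʳ p))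

  pos : Lower 0ℚ
  pos = let a , ua = upper-inhabited (real x) in a , ua , subst (_< 1ℚ) (sym (ℚ.*-zeroˡ a)) 0<1

  1<[i+1]a : ∀ a i → 0ℚ < a → a * i ≡ 1ℚ → 1ℚ < (i + 1ℚ) * a
  1<[i+1]a a i 0<a ai≡1 = subst (1ℚ <_) (sym (trans (expand a i) (cong (_+ a) ai≡1))) (p<p+ε 1ℚ 0<a)

  inh : ∃ Upper
  inh = let a , 0<a , la = lower-pos x
        in inv a 0<a + 1ℚ , a , 0<a , la , 1<[i+1]a a (inv a 0<a) 0<a (*-inv a 0<a)

  lopen′ : ∀ p a i m → 0ℚ < a → a * i ≡ 1ℚ → upper (real x) a → p * a < m → m < 1ℚ →
           ∃ λ q → p < q × Lower q
  lopen′ p a i m 0<a ai≡1 ua pa<m m<1 = m * i ,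
    *-cancelʳ-< {p} {m * i} {a} 0<a (subst (p * a <_) (sym (cancel m a i ai≡1)) pa<m) ,
    a , ua , subst (_< 1ℚ) (sym (cancel m a i ai≡1)) m<1

  lopen : ∀ {p} → Lower p → ∃ λ q → p < q × Lower q
  lopen {p} (a , ua , pa<1) =
    let m , pa<m , m<1 = ℚ.<-dense pa<1
        0<a            = upper⇒pos x ua
    in lopen′ p a (inv a 0<a) m 0<a (*-inv a 0<a) ua pa<m m<1

  uopen′ : ∀ q a i m → 0ℚ < a → a * i ≡ 1ℚ → lower (real x) a → 1ℚ < m → m < q * a →
           ∃ λ p → p < q × Upper p
  uopen′ q a i m 0<a ai≡1 la 1<m m<qa = m * i ,
    *-cancelʳ-< {m * i} {q} {a} 0<a (subst (_< q * a) (sym (cancel m a i ai≡1)) m<qa) ,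
    a , 0<a , la , subst (1ℚ <_) (sym (cancel m a i ai≡1)) 1<m

  uopen : ∀ {q} → Upper q → ∃ λ p → p < q × Upper p
  uopen {q} (a , 0<a , la , 1<qa) =
    let m , 1<m , m<qa = ℚ.<-dense 1<qa
    in uopen′ q a (inv a 0<a) m 0<a (*-inv a 0<a) la 1<m m<qa

  dis : ∀ {q} → Lower q → ¬ Upper q
  dis {q} (a , ua , qa<1) (b , 0<b , lb , 1<qb) =
    ℚ.<-asym (ℚ.<-trans 1<qb (*-monoʳ-< {b} {a} {q} 0<q (lower<upper (real x) lb ua))) qa<1
    where
    0<q : 0ℚ < q
    0<q = *-cancelʳ-< {0ℚ} {q} {b} 0<b (subst (_< q * b) (sym (ℚ.*-zeroˡ b)) (ℚ.<-trans 0<1 1<qb))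

  split : ∀ {p q} b b′ → 0ℚ < b → lower (real x) b → upper (real x) b′ → p * b′ < q * b →
          Lower p ⊎ Upper q
  split {p} {q} b b′ 0<b lb ub′ pb′<qb with p * b′ ℚ.<? 1ℚ
  ... | yes pb′<1 = inj₁ (b′ , ub′ , pb′<1)
  ... | no  pb′≮1 = inj₂ (b , 0<b , lb , ℚ.≤-<-trans (ℚ.≮⇒≥ pb′≮1) pb′<qb)

  loc : ∀ {p q} → p < q → Lower p ⊎ Upper q
  loc {p} {q} p<q with 0ℚ ℚ.<? p
  ... | no 0≮p = let a , ua = upper-inhabited (real x)
                 in inj₁ (a , ua , ℚ.≤-<-trans
                      (subst (p * a ≤_) (ℚ.*-zeroˡ a)
                        (*-monoˡ-≤ {p} {0ℚ} {a} (ℚ.<⇒≤ (upper⇒pos x ua)) (ℚ.≮⇒≥ 0≮p))) 0<1)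
  ... | yes 0<p =
    let b , b′ , 0<b , lb , ub′ , pb′<qb = approx⁺ x 0<p p<q
    in split {p} {q} b b′ 0<b lb ub′ pb′<qb

infixl 7 _÷⁺_

_÷⁺_ : ℝ⁺ → ℝ⁺ → ℝ⁺
x ÷⁺ y = x *⁺ recip y

-- The cut of lg x: for r > 0 and b ≥ 1,  (m − n)/b ≤ lg r  iff  2ᵐ ≤ 2ⁿ rᵇ,
-- so q < lg x  iff  q < (m − n)/b ≤ lg r  for some rational 0 < r < x, and dually.
record _<lg_ (q : ℚ) (x : ℝ⁺) : Set where
  field
    m n b     : ℕ
    r         : ℚ
    {{b≢0}}   : NonZero b
    0<r       : 0ℚ < r
    r<x       : lower (real x) r
    2ᵐ≤2ⁿrᵇ   : 2ℚ ^ m ≤ 2ℚ ^ n * r ^ b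
    q<[m-n]/b : q < (m ⊖ n) ℚ./ b

record _>lg_ (q : ℚ) (x : ℝ⁺) : Set where
  field
    m n b     : ℕ
    r         : ℚ
    {{b≢0}}   : NonZero b
    x<r       : upper (real x) r
    2ⁿrᵇ≤2ᵐ   : 2ℚ ^ n * r ^ b ≤ 2ℚ ^ m
    [m-n]/b<q : (m ⊖ n) ℚ./ b < q

lg : ℝ⁺ → ℝ
lg x = record
  { lower           = _<lg x
  ; upper           = _>lg x
  ; lower-inhabited = linh
  ; upper-inhabited = uinh
  ; lower-closed    = λ p<q h → let open _<lg_ h in record
      { m = m ; n = n ; b = b ; r = r ; b≢0 = b≢0 ; 0<r = 0<r ; r<x = r<x
      ; 2ᵐ≤2ⁿrᵇ = 2ᵐ≤2ⁿrᵇ ; q<[m-n]/b = ℚ.<-trans p<q q<[m-n]/b }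
  ; upper-closed    = λ p<q h → let open _>lg_ h in record
      { m = m ; n = n ; b = b ; r = r ; b≢0 = b≢0 ; x<r = x<r
      ; 2ⁿrᵇ≤2ᵐ = 2ⁿrᵇ≤2ᵐ ; [m-n]/b<q = ℚ.<-trans [m-n]/b<q p<q }
  ; lower-open      = λ h → let open _<lg_ h
                                q , p<q , q<f = ℚ.<-dense q<[m-n]/b
                            in q , p<q , record
      { m = m ; n = n ; b = b ; r = r ; b≢0 = b≢0 ; 0<r = 0<r ; r<x = r<x
      ; 2ᵐ≤2ⁿrᵇ = 2ᵐ≤2ⁿrᵇ ; q<[m-n]/b = q<f }
  ; upper-open      = λ h → let open _>lg_ h
                                p , f<p , p<q = ℚ.<-dense [m-n]/b<q
                            in p , p<q , record
      { m = m ; n = n ; b = b ; r = r ; b≢0 = b≢0 ; x<r = x<r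
      ; 2ⁿrᵇ≤2ᵐ = 2ⁿrᵇ≤2ᵐ ; [m-n]/b<q = f<p }
  ; disjoint        = λ {q} → dis {q}
  ; located         = loc
  }
  where
  p-1<p : ∀ p → p - 1ℚ < p
  p-1<p p = subst (p - 1ℚ <_) (solve 1 (λ p → p :- con 1ℚ :+ con 1ℚ := p) refl p) (p<p+ε (p - 1ℚ) 0<1)
    where open +-*-Solver

  linh′ : ∀ a n → 0ℚ < a → lower (real x) a → 1ℚ ≤ fromℕ n * a → ∃ (_<lg x)
  linh′ a n 0<a la h = (0 ⊖ n) ℚ./ 1 - 1ℚ , record
    { m = 0 ; n = n ; b = 1 ; r = a ; 0<r = 0<a ; r<x = la
    ; 2ᵐ≤2ⁿrᵇ = ℚ.≤-trans h (subst (λ z → fromℕ n * a ≤ 2ℚ ^ n * z) (sym (ℚ.*-identityʳ a))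
        (*-monoˡ-≤ {fromℕ n} {2ℚ ^ n} {a} (ℚ.<⇒≤ 0<a) (n≤2^n n)))
    ; q<[m-n]/b = p-1<p ((0 ⊖ n) ℚ./ 1) }

  linh : ∃ (_<lg x)
  linh =
    let a , 0<a , la = lower-pos x
        n , h        = archimedean 1ℚ 0<a
    in linh′ a n 0<a la h

  uinh′ : ∀ a m → upper (real x) a → a ≤ fromℕ m → ∃ (_>lg x)
  uinh′ a m ua h = (m ⊖ 0) ℚ./ 1 + 1ℚ , record
    { m = m ; n = 0 ; b = 1 ; r = a ; x<r = ua
    ; 2ⁿrᵇ≤2ᵐ = subst (_≤ 2ℚ ^ m) (sym (trans (ℚ.*-identityˡ (a * 1ℚ)) (ℚ.*-identityʳ a)))
        (ℚ.≤-trans h (n≤2^n m))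
    ; [m-n]/b<q = p<p+ε ((m ⊖ 0) ℚ./ 1) 0<1 }

  uinh : ∃ (_>lg x)
  uinh =
    let a , ua = upper-inhabited (real x)
        m , h  = bounded a
    in uinh′ a m ua h

  0<2^ : ∀ n → 0ℚ < 2ℚ ^ n
  0<2^ = ^-pos 0<2

  -- the conclusion is (m − n)/b < (m′ − n′)/b′ with denominators cleared
  exponents : ∀ m n b m′ n′ b′ {r r′} .{{_ : NonZero b}} .{{_ : NonZero b′}} → 0ℚ < r → r < r′ →
              2ℚ ^ m ≤ 2ℚ ^ n * r ^ b → 2ℚ ^ n′ * r′ ^ b′ ≤ 2ℚ ^ m′ →
              m ℕ.* b′ ℕ.+ n′ ℕ.* b ℕ.< n ℕ.* b′ ℕ.+ m′ ℕ.* b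
  exponents m n b m′ n′ b′ {r} {r′} 0<r r<r′ h h′ =
    2^-cancel-< {m ℕ.* b′ ℕ.+ n′ ℕ.* b} {n ℕ.* b′ ℕ.+ m′ ℕ.* b} (subst₂ _<_
      (sym (^-homo-* 2ℚ (m ℕ.* b′) (n′ ℕ.* b)))
      (sym (^-homo-* 2ℚ (n ℕ.* b′) (m′ ℕ.* b)))
      (chain (2ℚ ^ (m ℕ.* b′)) (2ℚ ^ (n ℕ.* b′)) (2ℚ ^ (m′ ℕ.* b)) (2ℚ ^ (n′ ℕ.* b))
        (r ^ (b ℕ.* b′)) (r′ ^ (b ℕ.* b′)) (0<2^ (n ℕ.* b′)) (0<2^ (n′ ℕ.* b))
        (^-monoˡ-< 0<r r<r′ (b ℕ.* b′) {{ℕ.m*n≢0 b b′}}) pow pow′))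
    where
    pow : 2ℚ ^ (m ℕ.* b′) ≤ 2ℚ ^ (n ℕ.* b′) * r ^ (b ℕ.* b′)
    pow = subst₂ _≤_ (^-assocʳ 2ℚ m b′)
      (trans (^-distrib-* (2ℚ ^ n) (r ^ b) b′) (cong₂ _*_ (^-assocʳ 2ℚ n b′) (^-assocʳ r b b′)))
      (^-monoˡ-≤ {2ℚ ^ m} {2ℚ ^ n * r ^ b} (0<2^ m) h b′)

    pow′ : 2ℚ ^ (n′ ℕ.* b) * r′ ^ (b ℕ.* b′) ≤ 2ℚ ^ (m′ ℕ.* b)
    pow′ = subst₂ _≤_
      (trans (^-distrib-* (2ℚ ^ n′) (r′ ^ b′) b)
        (cong₂ _*_ (^-assocʳ 2ℚ n′ b) (trans (^-assocʳ r′ b′ b) (cong (r′ ^_) (ℕ.*-comm b′ b)))))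
      (^-assocʳ 2ℚ m′ b)
      (^-monoˡ-≤ {2ℚ ^ n′ * r′ ^ b′} {2ℚ ^ m′}
        (*-pos {2ℚ ^ n′} {r′ ^ b′} (0<2^ n′) (^-pos (ℚ.<-trans 0<r r<r′) b′)) h′ b)

    rearrange : ∀ A B C → A * B * C ≡ A * (C * B)
    rearrange = solve 3 (λ A B C → A :* B :* C := A :* (C :* B)) refl
      where open +-*-Solver

    chain : ∀ M N M′ N′ R R′ → 0ℚ < N → 0ℚ < N′ → R < R′ → M ≤ N * R → N′ * R′ ≤ M′ →
            M * N′ < N * M′
    chain M N M′ N′ R R′ 0<N 0<N′ R<R′ h h′ =
      ℚ.≤-<-trans (*-monoˡ-≤ {M} {N * R} {N′} (ℚ.<⇒≤ 0<N′) h)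
        (ℚ.<-≤-trans (*-monoˡ-< {N * R} {N * R′} {N′} 0<N′ (*-monoʳ-< {R} {R′} {N} 0<N R<R′))
          (subst (_≤ N * M′) (sym (rearrange N R′ N′))
            (*-monoʳ-≤ {N′ * R′} {M′} {N} (ℚ.<⇒≤ 0<N) h′)))

  dis : ∀ {q} → q <lg x → ¬ (q >lg x)
  dis {q} h k = ℚ.<-asym (ℚ.<-trans L.q<[m-n]/b (⊖/-mono-< L.m L.n U.m U.n
    (exponents L.m L.n L.b U.m U.n U.b L.0<r (lower<upper (real x) L.r<x U.x<r)
      L.2ᵐ≤2ⁿrᵇ U.2ⁿrᵇ≤2ᵐ))) U.[m-n]/b<q
    where
    module L = _<lg_ h
    module U = _>lg_ k

  swap : ∀ A B C → A * (B * C) ≡ B * (A * C)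
  swap = solve 3 (λ A B C → A :* (B :* C) := B :* (A :* C)) refl
    where open +-*-Solver

  double : ∀ m n b g a a′ → 0ℚ < g → 0ℚ < a′ → a′ ≤ g * a → g ^ b ≤ 2ℚ →
           2ℚ ^ n * a ^ b ≤ 2ℚ ^ m → 2ℚ ^ n * a′ ^ b ≤ 2ℚ ^ suc m
  double m n b g a a′ 0<g 0<a′ a′≤ga gᵇ≤2 h = ℚ.≤-trans
    (*-monoʳ-≤ {a′ ^ b} {(g * a) ^ b} {2ℚ ^ n} (ℚ.<⇒≤ (0<2^ n)) (^-monoˡ-≤ {a′} {g * a} 0<a′ a′≤ga b))
    (subst (_≤ 2ℚ ^ suc m)
      (sym (trans (cong (2ℚ ^ n *_) (^-distrib-* g a b)) (swap (2ℚ ^ n) (g ^ b) (a ^ b))))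
      (*-mono-≤ {g ^ b} {2ℚ} {2ℚ ^ n * a ^ b} {2ℚ ^ m}
        (ℚ.<⇒≤ (^-pos 0<g b)) (ℚ.<⇒≤ (0<2^ m)) gᵇ≤2 h))

  decide : ∀ {p q} m n b (b≢0 : NonZero b) g a a′ →
           p < ℚ._/_ (m ⊖ n) b {{b≢0}} → ℚ._/_ (suc m ⊖ n) b {{b≢0}} < q →
           1ℚ < g → g ^ b ≤ 2ℚ → 0ℚ < a → lower (real x) a → upper (real x) a′ → 1ℚ * a′ < g * a →
           p <lg x ⊎ q >lg x
  decide m n b b≢0 g a a′ lo hi 1<g gᵇ≤2 0<a la ua′ a′<ga
    with ℚ.≤-total (2ℚ ^ m) (2ℚ ^ n * a ^ b)
  ... | inj₁ h = inj₁ record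
    { m = m ; n = n ; b = b ; r = a ; b≢0 = b≢0 ; 0<r = 0<a ; r<x = la
    ; 2ᵐ≤2ⁿrᵇ = h ; q<[m-n]/b = lo }
  ... | inj₂ h = inj₂ record
    { m = suc m ; n = n ; b = b ; r = a′ ; b≢0 = b≢0 ; x<r = ua′
    ; 2ⁿrᵇ≤2ᵐ = double m n b g a a′ (ℚ.<-trans 0<1 1<g) (upper⇒pos x ua′)
        (subst (_≤ g * a) (ℚ.*-identityˡ a′) (ℚ.<⇒≤ a′<ga)) gᵇ≤2 h
    ; [m-n]/b<q = hi }

  loc : ∀ {p q} → p < q → p <lg x ⊎ q >lg x
  loc p<q =
    let m , n , b , b≢0 , lo , hi           = consecutive p<q
        g , 1<g , gᵇ≤2                      = approx-root-of-2 b
        a , a′ , 0<a , la , ua′ , a′<ga     = approx⁺ x 0<1 1<g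
    in decide m n b b≢0 g a a′ lo hi 1<g gᵇ≤2 0<a la ua′ a′<ga

1⁺ : ℝ⁺
1⁺ = ι⁺ 1 ℕ.z<s

lg-positive : ∀ x → 1⁺ <⁺ x → lower (lg x) 0ℚ
lg-positive x (q , 1<q , q<x) =
  let n , h = archimedean 1ℚ (p<q⇒0<q-p 1<q)
      0<ε   = p<q⇒0<q-p 1<q
  in record
    { m = 1 ; n = 0 ; b = suc n ; r = q
    ; 0<r = ℚ.<-trans 0<1 1<q
    ; r<x = q<x
    ; 2ᵐ≤2ⁿrᵇ = subst (2ℚ ≤_) (trans (cong (_^ suc n) (p+[q-p]≡q 1ℚ q)) (sym (ℚ.*-identityˡ _)))
        (ℚ.≤-trans (ℚ.+-monoʳ-≤ 1ℚ (ℚ.≤-trans h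
            (*-monoˡ-≤ (ℚ.<⇒≤ 0<ε) (fromℕ-mono-≤ (ℕ.n≤1+n n)))))
          (bernoulli (ℚ.<⇒≤ 0<ε) (suc n)))
    ; q<[m-n]/b = /-mono-< (ℤ.+ 0) (ℤ.+ 1) 1 (suc n) (ℤ.+<+ ℕ.z<s)
    }

lg⁺ : (x : ℝ⁺) → 1⁺ <⁺ x → ℝ⁺
lg⁺ x 1<x = lg x ,⁺ lg-positive x 1<x

1<m÷n : ∀ {m n} (0<m : 0 ℕ.< m) (0<n : 0 ℕ.< n) → n ℕ.< m → 1⁺ <⁺ ι⁺ m 0<m ÷⁺ ι⁺ n 0<n
1<m÷n {m} {n} 0<m 0<n n<m =
  let c , n<c , c<m     = ℚ.<-dense (fromℕ-mono-< n<m)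
      a , c<a , a<m     = ℚ.<-dense c<m
      0<c               = ℚ.<-trans (fromℕ-mono-< 0<n) n<c
      0<a               = ℚ.<-trans 0<c c<a
      b , a⁻¹<b , b<c⁻¹ = ℚ.<-dense (inv-anti 0<c 0<a c<a)
      1<ab              = subst (_< a * b) (*-inv a 0<a) (*-monoʳ-< 0<a a⁻¹<b)
      bc<1              = subst (b * c <_) (trans (ℚ.*-comm _ c) (*-inv c 0<c)) (*-monoˡ-< 0<c b<c⁻¹)
      q , 1<q , q<ab    = ℚ.<-dense 1<ab
  in q , 1<q , a , b , 0<a , ℚ.<-trans (inv-pos a 0<a) a⁻¹<b , a<m , (c , n<c , bc<1) , q<ab
  where
  inv-anti : ∀ {c a} (0<c : 0ℚ < c) (0<a : 0ℚ < a) → c < a → inv a 0<a < inv c 0<c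
  inv-anti {c} {a} 0<c 0<a c<a = *-cancelʳ-< (*-pos 0<c 0<a) (subst₂ _<_
    (sym (trans (eq₁ c a (inv a 0<a)) (trans (cong (c *_) (*-inv a 0<a)) (ℚ.*-identityʳ c))))
    (sym (trans (eq₂ c a (inv c 0<c)) (trans (cong (a *_) (*-inv c 0<c)) (ℚ.*-identityʳ a))))
    c<a)
    where
    open +-*-Solver
    eq₁ : ∀ c a i → i * (c * a) ≡ c * (a * i)
    eq₁ = solve 3 (λ c a i → i :* (c :* a) := c :* (a :* i)) refl
    eq₂ : ∀ c a i → i * (c * a) ≡ a * (c * i)
    eq₂ = solve 3 (λ c a i → i :* (c :* a) := a :* (c :* i)) refl

pair : ∀ {u} → Fin u → Fin u → Fin (u ℕ.* u)
pair = combine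

-- The pair (x , y) belongs to the set iff its code, pair x y, belongs to pairs.
record Input (n u : ℕ) : Set where
  field
    pairs       : Subset (u ℕ.* u)
    .size       : ∣ pairs ∣ ≡ n
    .functional : ∀ (x y y′ : Fin u) → pair x y ∈ pairs → pair x y′ ∈ pairs → y ≡ y′

open Input

IsAnswer : ∀ {n u} → Input n u → Fin u → Maybe (Fin u) → Set
IsAnswer X x (just y) = pair x y ∈ pairs X
IsAnswer X x nothing  = ∀ y → pair x y ∉ pairs X

Cell : ℕ → Set
Cell w = Vec Bool w

Memory : ℕ → ℕ → Set
Memory s w = Vec (Cell w) s

-- The contents of the probed cells, tagged by address: entry a is nothing iff
-- cell a is not probed.
View : ℕ → ℕ → Set
View s w = Vec (Maybe (Cell w)) s

probe : ∀ {s w} → Subset s → Memory s w → View s w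
probe = zipWith (λ probed cell → if probed then just cell else nothing)

-- Non-adaptivity: probes sees only the query, not the input or the memory.
record NonAdaptiveDictionary (n u s w : ℕ) : Set where
  field
    store   : Input n u → Memory s w
    probes  : Fin u → Subset s
    answer  : Fin u → View s w → Maybe (Fin u)
    correct : ∀ X x → IsAnswer X x (answer x (probe (probes x) (store X)))

  QueryTime≤ : ℕ → Set
  QueryTime≤ t = ∀ x → ∣ probes x ∣ ℕ.≤ t

{-# OPTIONS --safe #-}

-- Write L = lg (u / n) and r = s w / (n L).  If all keys of n disjoint blocks of q keys are
-- probed inside a set of k cells, then these cells encode a free choice of one key-value pair
-- per block, so (q u)ⁿ ≤ 2^(k w).  With q = ⌊u / n⌋ and all s cells this gives 2 ≤ r.  With q = 1
-- it says that k cells cover fewer than n keys as soon as k w < n L.  But discarding, one at a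
-- time, a cell probed by the fewest surviving keys leaves k cells that cover at least
-- u · k(k − 1)⋯(k − t + 1) / (s(s − 1)⋯(s − t + 1)) keys.  Take k maximal with k w < n L.  Either
-- n L / w ≤ k + 1 ≤ 4 t, or t ≤ k / 4 and u / n ≤ (2 s / (k + 1))ᵗ ≤ r²ᵗ, that is, L ≤ 2 t lg r.
module Submission where

module Counting where

  open import Data.Bool.Base using (Bool; true; false; if_then_else_)
  open import Data.Fin.Base using (Fin; zero; suc; combine; remQuot; finToFun; funToFin; inject≤)
  open import Data.Fin.Properties as Fin
    using (combine-injective; combine-remQuot; funToFin-finToFin; inject≤-injective; injective⇒≤; 0≢1+n)
  open import Data.Fin.Subset using (Subset; inside; outside; _∈_; _∉_; _⊆_; _-_; ⊤; ⊥; ∣_∣)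
  open import Data.Fin.Subset.Properties
    using (_⊆?_; x∈p∧x≢y⇒x∈p-y; ∣⊤∣≡n; ∉⊥; ∣⊥∣≡0; ⊆⊤; drop-there; p─⊥≡p)
  open import Data.Maybe.Base using (Maybe; just; nothing)
  open import Data.Nat.Base hiding (∣_-_∣)
  open import Data.Nat.DivMod using (m%n<n; m≡m%n+[m/n]*n; m/n*n≤m; m≥n⇒m/n>0)
  open import Data.Nat.Properties hiding (0≢1+n)
  open import Data.Nat.Solver using (module +-*-Solver)
  open import Data.Product.Base using (∃; _×_; _,_; proj₁; proj₂)
  open import Data.Sum.Base using (_⊎_; inj₁; inj₂)
  open import Data.Vec.Base using (Vec; []; _∷_; _++_; lookup; tabulate; _[_]≔_; here; there)
  open import Data.Vec.Properties
    using (lookup⇒[]=; []=⇒lookup; lookup∘tabulate; []≔-updates; []≔-minimal; lookup∘update′; ++-injective)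
  open import Function.Base using (_∘_; const)
  open import Function.Definitions using (Injective)
  open import Relation.Binary.PropositionalEquality
  open import Relation.Nullary.Decidable.Core using (Dec; does; yes; no)
  open import Relation.Nullary.Negation.Core using (¬_; contradiction)
  open import Algebra.Properties.CommutativeSemigroup *-commutativeSemigroup
    using (x∙yz≈y∙xz; xy∙z≈zx∙y)
  open import Algebra.Properties.Semiring.Sum +-*-semiring
    using (sum; sum-syntax; ∑-comm; ∑-distrib-+; *-distribˡ-sum; sum-cong-≗)
  open import Defs

  private
    variable
      j k m n s t u w : ℕ

  -- Information content of a set of cells.

  bits→Fin : Vec Bool m → Fin (2 ^ m)
  bits→Fin []          = zero
  bits→Fin (false ∷ v) = combine {2} zero (bits→Fin v)
  bits→Fin (true ∷ v)  = combine {2} (suc zero) (bits→Fin v)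

  bits→Fin-injective : Injective _≡_ _≡_ (bits→Fin {m})
  bits→Fin-injective {x = []}        {[]}        _  = refl
  bits→Fin-injective {x = false ∷ v} {false ∷ v′} eq =
    cong (false ∷_) (bits→Fin-injective (proj₂ (combine-injective {2} zero (bits→Fin v) zero _ eq)))
  bits→Fin-injective {x = true ∷ v}  {true ∷ v′}  eq =
    cong (true ∷_) (bits→Fin-injective (proj₂ (combine-injective {2} (suc zero) (bits→Fin v) (suc zero) _ eq)))
  bits→Fin-injective {x = false ∷ v} {true ∷ v′}  eq =
    contradiction (proj₁ (combine-injective {2} zero (bits→Fin v) (suc zero) _ eq)) 0≢1+n
  bits→Fin-injective {x = true ∷ v}  {false ∷ v′} eq =
    contradiction (sym (proj₁ (combine-injective {2} (suc zero) (bits→Fin v) zero _ eq))) 0≢1+n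

  restrict : (S : Subset s) → Memory s w → Vec Bool (∣ S ∣ * w)
  restrict []            []      = []
  restrict (inside ∷ S)  (c ∷ M) = c ++ restrict S M
  restrict (outside ∷ S) (c ∷ M) = restrict S M

  -- An unprobed cell shows as `nothing` in both views, and a probed one lies in `S`, where the two
  -- memories agree.
  probe-restrict : (P S : Subset s) (M M′ : Memory s w) → P ⊆ S →
                   restrict S M ≡ restrict S M′ → probe P M ≡ probe P M′
  probe-restrict []      []      []      []        P⊆S eq = refl
  probe-restrict (p ∷ P) (inside ∷ S) (c ∷ M) (c′ ∷ M′) P⊆S eq =
    let c≡c′ , eq′ = ++-injective c c′ eq
    in cong₂ _∷_ (cong (λ c → if p then just c else nothing) c≡c′)
         (probe-restrict P S M M′ (drop-there ∘ P⊆S ∘ there) eq′)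
  probe-restrict (inside ∷ P)  (outside ∷ S) (c ∷ M) (c′ ∷ M′) P⊆S eq with () ← P⊆S here
  probe-restrict (outside ∷ P) (outside ∷ S) (c ∷ M) (c′ ∷ M′) P⊆S eq =
    cong (nothing ∷_) (probe-restrict P S M M′ (drop-there ∘ P⊆S ∘ there) eq)

  image : (Fin n → Fin m) → Subset m
  image {zero}  f = ⊥
  image {suc n} f = image (f ∘ suc) [ f zero ]≔ inside

  ∈-[]≔⁻ : (p : Subset m) (x y : Fin m) → y ∈ p [ x ]≔ inside → y ≡ x ⊎ y ∈ p
  ∈-[]≔⁻ p x y y∈ with y Fin.≟ x
  ... | yes y≡x = inj₁ y≡x
  ... | no  y≢x = inj₂ (lookup⇒[]= y p (trans (sym (lookup∘update′ y≢x p inside)) ([]=⇒lookup y∈)))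

  ∈-image⁺ : (f : Fin n → Fin m) (i : Fin n) → f i ∈ image f
  ∈-image⁺ {suc n} f zero = []≔-updates (image (f ∘ suc)) (f zero)
  ∈-image⁺ {suc n} f (suc i) with f (suc i) Fin.≟ f zero
  ... | yes eq = subst (_∈ image f) (sym eq) ([]≔-updates (image (f ∘ suc)) (f zero))
  ... | no neq = []≔-minimal (image (f ∘ suc)) (f (suc i)) (f zero) neq (∈-image⁺ (f ∘ suc) i)

  ∈-image⁻ : (f : Fin n → Fin m) {y : Fin m} → y ∈ image f → ∃ λ i → y ≡ f i
  ∈-image⁻ {zero}  f y∈ = contradiction y∈ ∉⊥
  ∈-image⁻ {suc n} f {y} y∈ with ∈-[]≔⁻ (image (f ∘ suc)) (f zero) y y∈
  ... | inj₁ eq = zero , eq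
  ... | inj₂ y∈′ = let i , eq = ∈-image⁻ (f ∘ suc) y∈′ in suc i , eq

  ∣p[x]≔inside∣ : (p : Subset m) (x : Fin m) → x ∉ p → ∣ p [ x ]≔ inside ∣ ≡ suc ∣ p ∣
  ∣p[x]≔inside∣ (inside ∷ p)  zero    x∉p = contradiction here x∉p
  ∣p[x]≔inside∣ (outside ∷ p) zero    x∉p = refl
  ∣p[x]≔inside∣ (inside ∷ p)  (suc x) x∉p = cong suc (∣p[x]≔inside∣ p x (x∉p ∘ there))
  ∣p[x]≔inside∣ (outside ∷ p) (suc x) x∉p = ∣p[x]≔inside∣ p x (x∉p ∘ there)

  ∣image∣ : (f : Fin n → Fin m) → Injective _≡_ _≡_ f → ∣ image f ∣ ≡ n
  ∣image∣ {zero}  {m} f inj = ∣⊥∣≡0 m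
  ∣image∣ {suc n} f inj = trans
    (∣p[x]≔inside∣ (image (f ∘ suc)) (f zero)
      λ h → let i , eq = ∈-image⁻ (f ∘ suc) h in 0≢1+n (inj eq))
    (cong suc (∣image∣ (f ∘ suc) (Fin.suc-injective ∘ inj)))

  element : (p : Subset m) → Fin ∣ p ∣ → Fin m
  element (inside ∷ p)  zero    = zero
  element (inside ∷ p)  (suc i) = suc (element p i)
  element (outside ∷ p) i       = suc (element p i)

  element-∈ : (p : Subset m) (i : Fin ∣ p ∣) → element p i ∈ p
  element-∈ (inside ∷ p)  zero    = here
  element-∈ (inside ∷ p)  (suc i) = there (element-∈ p i)
  element-∈ (outside ∷ p) i       = there (element-∈ p i)

  element-injective : (p : Subset m) → Injective _≡_ _≡_ (element p)
  element-injective (inside ∷ p)  {zero}  {zero}  eq = refl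
  element-injective (inside ∷ p)  {suc i} {suc j} eq =
    cong suc (element-injective p (Fin.suc-injective eq))
  element-injective (outside ∷ p) eq = element-injective p (Fin.suc-injective eq)

  -- Row i of key is the i-th block of keys; an input takes one key from each block.
  module Capacity {q : ℕ} (D : NonAdaptiveDictionary n u s w) (S : Subset s)
    (key : Fin n → Fin q → Fin u)
    (key-injective : ∀ {i i′ j j′} → key i j ≡ key i′ j′ → i ≡ i′ × j ≡ j′)
    (probes⊆S : ∀ i j → NonAdaptiveDictionary.probes D (key i j) ⊆ S) where

    open NonAdaptiveDictionary D

    -- The position of a key in its block and its value are coded as one number, so that `finToFun`
    -- enumerates the choices by `Fin ((q * u) ^ n)`.
    Choice : Set
    Choice = Fin n → Fin (q * u)

    keyOf : Choice → Fin n → Fin u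
    keyOf g i = key i (proj₁ (remQuot {q} u (g i)))

    valueOf : Choice → Fin n → Fin u
    valueOf g i = proj₂ (remQuot {q} u (g i))

    entry : Choice → Fin n → Fin (u * u)
    entry g i = pair (keyOf g i) (valueOf g i)

    entry-injective : ∀ g → Injective _≡_ _≡_ (entry g)
    entry-injective g eq = proj₁ (key-injective (proj₁ (combine-injective _ _ _ _ eq)))

    entry-functional : ∀ g x y y′ → pair x y ∈ image (entry g) → pair x y′ ∈ image (entry g) → y ≡ y′
    entry-functional g x y y′ h h′ =
      let i  , eq   = ∈-image⁻ (entry g) h
          i′ , eq′  = ∈-image⁻ (entry g) h′
          x≡  , y≡  = combine-injective x y _ _ eq
          x≡′ , y≡′ = combine-injective x y′ _ _ eq′
          i≡i′      = proj₁ (key-injective (trans (sym x≡) x≡′))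
      in trans y≡ (trans (cong (valueOf g) i≡i′) (sym y≡′))

    input : Choice → Input n u
    input g = record
      { pairs      = image (entry g)
      ; size       = ∣image∣ (entry g) (entry-injective g)
      ; functional = entry-functional g
      }

    -- One answer that is correct for both inputs reveals the choice in block `i`. It cannot be
    -- `nothing`, as `g` uses the key. If it is `just y`, the key also occurs in the input of `g′`,
    -- by `key-injective` in row `i` and at the same position, and `y` is the value on both sides.
    answered : ∀ (g g′ : Choice) i a → IsAnswer (input g) (keyOf g i) a →
               IsAnswer (input g′) (keyOf g i) a → g i ≡ g′ i
    answered g g′ i nothing  h h′ = contradiction (∈-image⁺ (entry g) i) (h (valueOf g i))
    answered g g′ i (just y) h h′ =
      let i″ , eq  = ∈-image⁻ (entry g′) h′
          x≡ , y≡  = combine-injective (keyOf g i) y _ _ eq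
          i≡ , j≡  = key-injective x≡
          y≡v      = entry-functional g (keyOf g i) y (valueOf g i) h (∈-image⁺ (entry g) i)
          gi≡g′i″  = trans (sym (combine-remQuot {q} u (g i)))
                       (trans (cong₂ combine j≡ (trans (sym y≡v) y≡)) (combine-remQuot {q} u (g′ i″)))
      in trans gi≡g′i″ (cong g′ (sym i≡))

    encode : Fin ((q * u) ^ n) → Fin (2 ^ (∣ S ∣ * w))
    encode c = bits→Fin (restrict S (store (input (finToFun c))))

    funToFin-cong : ∀ {a b} {f g : Fin a → Fin b} → f ≗ g → funToFin f ≡ funToFin g
    funToFin-cong {zero}  f≗g = refl
    funToFin-cong {suc a} f≗g = cong₂ combine (f≗g zero) (funToFin-cong (f≗g ∘ suc))

    encode-injective : Injective _≡_ _≡_ encode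
    encode-injective {c} {c′} eq = trans (sym (funToFin-finToFin {n} {q * u} c))
      (trans (funToFin-cong same) (funToFin-finToFin {n} {q * u} c′))
      where
      g  = finToFun {q * u} {n} c
      g′ = finToFun {q * u} {n} c′
      same : g ≗ g′
      -- The query is the key that `g` picks in block `i`. It probes the same cells of both
      -- memories, all in `S`, so the views coincide and the answer is correct for `g′` as well,
      -- whether or not `g′` uses this key.
      same i = answered g g′ i (answer x (probe (probes x) (store (input g))))
        (correct (input g) x)
        (subst (λ v → IsAnswer (input g′) x (answer x v))
          (sym (probe-restrict (probes x) S (store (input g)) (store (input g′))
            (probes⊆S i _) (bits→Fin-injective eq)))
          (correct (input g′) x))
        where x = keyOf g i

    capacity : (q * u) ^ n ≤ 2 ^ (∣ S ∣ * w)
    capacity = injective⇒≤ encode-injective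

  ^-distribʳ-* : ∀ k m n → (m * n) ^ k ≡ m ^ k * n ^ k
  ^-distribʳ-* zero    m n = refl
  ^-distribʳ-* (suc k) m n = trans (cong (m * n *_) (^-distribʳ-* k m n))
    (solve 4 (λ m n x y → m :* n :* (x :* y) := m :* x :* (n :* y)) refl m n (m ^ k) (n ^ k))
    where open +-*-Solver

  -- In logarithms, 2 n L ≤ s w. Free values alone give only u choices per block, hence r ≥ 1; a
  -- free key among `q` raises this to q u, which is at least (u / n)².
  memory-bound : NonAdaptiveDictionary n u s w → 1 ≤ n → n < u →
                 (u * u) ^ n ≤ 2 ^ (s * w) * (n * n) ^ n
  memory-bound {n@(suc n-1)} {u} {s} {w} D 1≤n n<u = begin
    (u * u) ^ n                ≤⟨ ^-monoˡ-≤ n (*-monoˡ-≤ u u≤nnq) ⟩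
    (n * (n * q) * u) ^ n      ≡⟨ cong (_^ n) (solve 3 (λ n q u → n :* (n :* q) :* u := q :* u :* (n :* n)) refl n q u) ⟩
    (q * u * (n * n)) ^ n      ≡⟨ ^-distribʳ-* n (q * u) (n * n) ⟩
    (q * u) ^ n * (n * n) ^ n  ≤⟨ *-monoˡ-≤ ((n * n) ^ n) count ⟩
    2 ^ (s * w) * (n * n) ^ n  ∎
    where
    open ≤-Reasoning
    open +-*-Solver
    q = u / n
    nq≤u : n * q ≤ u
    nq≤u = subst (_≤ u) (*-comm q n) (m/n*n≤m u n)
    instance
      nq≢0 : NonZero (n * q)
      nq≢0 = m*n≢0 n q {{_}} {{>-nonZero (m≥n⇒m/n>0 (<⇒≤ n<u))}}
    -- This crude bound suffices, since q u ≥ (u / n)² amounts to u ≤ n² q. The remainder of u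
    -- modulo n is at most `n-1`, and as n q ≥ 1 it is absorbed by `n-1` further copies of n q.
    u≤nnq : u ≤ n * (n * q)
    u≤nnq = begin
      u                          ≡⟨ m≡m%n+[m/n]*n u n ⟩
      u % n + q * n              ≤⟨ +-monoˡ-≤ (q * n) (≤-pred (m%n<n u n)) ⟩
      n-1 + q * n                ≡⟨ trans (+-comm n-1 (q * n)) (cong (_+ n-1) (*-comm q n)) ⟩
      n * q + n-1                ≤⟨ +-monoʳ-≤ (n * q) (m≤m*n n-1 (n * q)) ⟩
      n * q + n-1 * (n * q)      ∎
    key : Fin n → Fin q → Fin u
    key i j = inject≤ (combine i j) nq≤u
    count : (q * u) ^ n ≤ 2 ^ (s * w)
    count = subst (λ z → (q * u) ^ n ≤ 2 ^ (z * w)) (∣⊤∣≡n s)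
      (Capacity.capacity D ⊤ key
        (λ {i} {i′} {j} {j′} eq → combine-injective i j i′ j′ (inject≤-injective nq≤u nq≤u _ _ eq))
        (λ _ _ → ⊆⊤))

  -- Falling factorials and averaging over a finite set.

  falling : ℕ → ℕ → ℕ
  falling n zero    = 1
  falling n (suc t) = n * falling (n ∸ 1) t

  -- The last factor is split off here, the first one in the definition. Together they relate
  -- `falling k t` to `falling (suc k) t`, as the removal of one cell requires.
  falling-suc : ∀ n t → falling n t * (n ∸ t) ≡ falling n (suc t)
  falling-suc n       zero    = trans (*-identityˡ n) (sym (*-identityʳ n))
  falling-suc zero    (suc t) = refl
  falling-suc (suc n) (suc t) = trans (*-assoc (suc n) (falling n t) (n ∸ t))
    (cong (suc n *_) (falling-suc n t))

  falling≤^ : ∀ n t → falling n t ≤ n ^ t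
  falling≤^ n zero    = ≤-refl
  falling≤^ n (suc t) = *-monoʳ-≤ n (≤-trans (falling≤^ (n ∸ 1) t) (^-monoˡ-≤ t (m∸n≤m n 1)))

  ^≤falling : ∀ n t → (n ∸ t) ^ t ≤ falling n t
  ^≤falling n zero    = ≤-refl
  ^≤falling n (suc t) = *-mono-≤ (m∸n≤m n (suc t))
    (subst (λ k → k ^ t ≤ falling (n ∸ 1) t) (∸-+-assoc n 1 t) (^≤falling (n ∸ 1) t))

  𝟙 : Bool → ℕ
  𝟙 b = if b then 1 else 0

  ∑-mono-≤ : {f g : Fin m → ℕ} → (∀ i → f i ≤ g i) → sum f ≤ sum g
  ∑-mono-≤ {zero}  f≤g = z≤n
  ∑-mono-≤ {suc m} f≤g = +-mono-≤ (f≤g zero) (∑-mono-≤ (f≤g ∘ suc))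

  ∣p∣≡∑ : (p : Subset m) → ∣ p ∣ ≡ sum (𝟙 ∘ lookup p)
  ∣p∣≡∑ []            = refl
  ∣p∣≡∑ (inside ∷ p)  = cong suc (∣p∣≡∑ p)
  ∣p∣≡∑ (outside ∷ p) = ∣p∣≡∑ p

  argmax : (p : Subset m) (f : Fin m → ℕ) →
           (∀ b → b ∉ p) ⊎ ∃ λ a → a ∈ p × (∀ b → b ∈ p → f b ≤ f a)
  argmax []            f = inj₁ λ ()
  argmax (outside ∷ p) f with argmax p (f ∘ suc)
  ... | inj₁ none          = inj₁ λ { (suc b) (there b∈p) → none b b∈p }
  ... | inj₂ (a , a∈p , h) = inj₂ (suc a , there a∈p , λ { (suc b) (there b∈p) → h b b∈p })
  argmax (inside ∷ p)  f with argmax p (f ∘ suc)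
  ... | inj₁ none = inj₂ (zero , here , λ
    { zero    here        → ≤-refl
    ; (suc b) (there b∈p) → contradiction b∈p (none b) })
  ... | inj₂ (a , a∈p , h) with ≤-total (f zero) (f (suc a))
  ... | inj₁ f0≤fa = inj₂ (suc a , there a∈p , λ
    { zero    here        → f0≤fa
    ; (suc b) (there b∈p) → h b b∈p })
  ... | inj₂ fa≤f0 = inj₂ (zero , here , λ
    { zero    here        → ≤-refl
    ; (suc b) (there b∈p) → ≤-trans (h b b∈p) fa≤f0 })

  ∣p∣≢0 : (p : Subset m) → ∣ p ∣ ≡ suc k → ¬ (∀ b → b ∉ p)
  ∣p∣≢0 (inside ∷ p)  eq none = none zero here
  ∣p∣≢0 (outside ∷ p) eq none = ∣p∣≢0 p eq (λ b → none (suc b) ∘ there)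

  weighted≤ : (p : Subset m) (f : Fin m → ℕ) (k : ℕ) → (∀ b → b ∈ p → f b ≤ k) →
              ∑[ b < m ] (𝟙 (lookup p b) * f b) ≤ ∣ p ∣ * k
  weighted≤ []            f k f≤k = z≤n
  weighted≤ (inside ∷ p)  f k f≤k = +-mono-≤ (subst (_≤ k) (sym (*-identityˡ (f zero))) (f≤k zero here))
    (weighted≤ p (f ∘ suc) k (λ b → f≤k (suc b) ∘ there))
  weighted≤ (outside ∷ p) f k f≤k = weighted≤ p (f ∘ suc) k (λ b → f≤k (suc b) ∘ there)

  above-average : (p : Subset m) (f : Fin m → ℕ) → ∣ p ∣ ≡ suc k →
                  ∃ λ a → a ∈ p × ∑[ b < m ] (𝟙 (lookup p b) * f b) ≤ suc k * f a
  above-average p f eq with argmax p f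
  ... | inj₁ none          = contradiction none (∣p∣≢0 p eq)
  ... | inj₂ (a , a∈p , h) = a , a∈p , subst (λ k → ∑[ b < _ ] (𝟙 (lookup p b) * f b) ≤ k * f a) eq (weighted≤ p f (f a) h)

  ∣p-x∣ : (p : Subset m) (x : Fin m) → x ∈ p → ∣ p ∣ ≡ suc k → ∣ p - x ∣ ≡ k
  ∣p-x∣ (inside ∷ p)  zero    here        eq = trans (cong ∣_∣ (p─⊥≡p p)) (suc-injective eq)
  ∣p-x∣ {k = zero} (inside ∷ p)  (suc x) (there x∈p) eq =
    contradiction x∈p (λ x∈p → ∣p∣≡0⇒x∉p p (suc-injective eq) x x∈p)
    where
    ∣p∣≡0⇒x∉p : (p : Subset m) → ∣ p ∣ ≡ 0 → ∀ x → x ∉ p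
    ∣p∣≡0⇒x∉p (outside ∷ p) eq (suc x) (there x∈p) = ∣p∣≡0⇒x∉p p eq x x∈p
  ∣p-x∣ {k = suc k} (inside ∷ p)  (suc x) (there x∈p) eq = cong suc (∣p-x∣ p x x∈p (suc-injective eq))
  ∣p-x∣ (outside ∷ p) (suc x) (there x∈p) eq = ∣p-x∣ p x x∈p eq

  -- Small sets of cells that cover many keys.

  module Covering (P : Fin u → Subset s) (t : ℕ) (∣P∣≤t : ∀ x → ∣ P x ∣ ≤ t) where

    covers : Subset s → Fin u → ℕ
    covers T x = 𝟙 (does (P x ⊆? T))

    covered : Subset s → ℕ
    covered T = sum (covers T)

    -- A covered key survives the removal of every cell of `T` that it does not probe, and it probes
    -- at most `t`. The loss is added on the right to avoid truncated subtraction.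
    covers-remove : ∀ T x → ∣ T ∣ * covers T x ≤
                    ∑[ a < s ] (𝟙 (lookup T a) * covers (T - a) x) + t * covers T x
    covers-remove T x with P x ⊆? T
    ... | no  _   = ≤-trans (≤-reflexive (*-zeroʳ ∣ T ∣)) z≤n
    ... | yes P⊆T = begin
      ∣ T ∣ * 1                                   ≡⟨ trans (*-identityʳ ∣ T ∣) (∣p∣≡∑ T) ⟩
      sum (𝟙 ∘ lookup T)                          ≤⟨ ∑-mono-≤ pointwise ⟩
      ∑[ a < s ] (kept a + 𝟙 (lookup (P x) a))    ≡⟨ ∑-distrib-+ kept (𝟙 ∘ lookup (P x)) ⟩
      sum kept + sum (𝟙 ∘ lookup (P x))           ≡⟨ cong (sum kept +_) (sym (∣p∣≡∑ (P x))) ⟩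
      sum kept + ∣ P x ∣                           ≤⟨ +-monoʳ-≤ (sum kept) (∣P∣≤t x) ⟩
      sum kept + t                                ≡⟨ cong (sum kept +_) (sym (*-identityʳ t)) ⟩
      sum kept + t * 1                            ∎
      where
      open ≤-Reasoning
      kept : Fin s → ℕ
      kept a = 𝟙 (lookup T a) * covers (T - a) x
      -- A cell of `T` is either probed by `x` or can be removed with `x` still covered.
      pointwise : ∀ a → 𝟙 (lookup T a) ≤ kept a + 𝟙 (lookup (P x) a)
      pointwise a with lookup (P x) a in eq
      ... | true  = ≤-trans (𝟙≤1 (lookup T a)) (m≤n+m 1 (kept a))
        where
        𝟙≤1 : ∀ b → 𝟙 b ≤ 1
        𝟙≤1 true  = ≤-refl
        𝟙≤1 false = z≤n
      ... | false with P x ⊆? (T - a)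
      ... | yes _ = ≤-reflexive (sym (trans (+-identityʳ _) (*-identityʳ _)))
      ... | no P⊈T-a = contradiction
        (λ {y} y∈P → x∈p∧x≢y⇒x∈p-y (P⊆T y∈P)
          (λ { refl → contradiction (trans (sym ([]=⇒lookup y∈P)) eq) λ () }))
        P⊈T-a

    -- Double counting: `covers-remove` is summed over all keys, and exchanging the sums counts the
    -- survivors cell by cell.
    covered-remove : ∀ T → ∣ T ∣ * covered T ≤
                     ∑[ a < s ] (𝟙 (lookup T a) * covered (T - a)) + t * covered T
    covered-remove T = begin
      ∣ T ∣ * covered T
        ≡⟨ *-distribˡ-sum ∣ T ∣ (covers T) ⟩
      ∑[ x < u ] (∣ T ∣ * covers T x)
        ≤⟨ ∑-mono-≤ (covers-remove T) ⟩
      ∑[ x < u ] (∑[ a < s ] kept a x + t * covers T x)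
        ≡⟨ ∑-distrib-+ (λ x → ∑[ a < s ] kept a x) (λ x → t * covers T x) ⟩
      ∑[ x < u ] ∑[ a < s ] kept a x + ∑[ x < u ] (t * covers T x)
        ≡⟨ cong₂ _+_ (∑-comm (λ x a → kept a x)) (sym (*-distribˡ-sum t (covers T))) ⟩
      ∑[ a < s ] ∑[ x < u ] kept a x + t * covered T
        ≡⟨ cong (_+ t * covered T) (sum-cong-≗ (λ a → sym (*-distribˡ-sum (𝟙 (lookup T a)) (covers (T - a))))) ⟩
      ∑[ a < s ] (𝟙 (lookup T a) * covered (T - a)) + t * covered T ∎
      where
      open ≤-Reasoning
      kept : Fin s → Fin u → ℕ
      kept a x = 𝟙 (lookup T a) * covers (T - a) x

    -- Some cell leaves at least the average number of survivors when removed; it is one probed by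
    -- the fewest covered keys.
    remove-cell : ∀ T → ∣ T ∣ ≡ suc j → ∃ λ T′ → ∣ T′ ∣ ≡ j ×
                  (suc j ∸ t) * covered T ≤ suc j * covered T′
    remove-cell {j} T ∣T∣ =
      let a , a∈T , h = above-average T (λ a → covered (T - a)) ∣T∣
      in T - a , ∣p-x∣ T a a∈T ∣T∣ , (begin
        (suc j ∸ t) * covered T                ≡⟨ *-distribʳ-∸ (covered T) (suc j) t ⟩
        suc j * covered T ∸ t * covered T      ≤⟨ m≤n+o⇒m∸n≤o (suc j * covered T) (t * covered T)
          (begin
            suc j * covered T                    ≡⟨ cong (_* covered T) (sym ∣T∣) ⟩
            ∣ T ∣ * covered T                      ≤⟨ covered-remove T ⟩
            _ + t * covered T                    ≤⟨ +-monoˡ-≤ (t * covered T) h ⟩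
            suc j * covered (T - a) + t * covered T ≡⟨ +-comm _ (t * covered T) ⟩
            t * covered T + suc j * covered (T - a) ∎) ⟩
        suc j * covered (T - a)                ∎)
      where open ≤-Reasoning

    covered-⊤ : covered ⊤ ≡ u
    covered-⊤ = trans (sum-cong-≗ {u} all) (sum-1 u)
      where
      all : ∀ x → covers ⊤ x ≡ 1
      all x with P x ⊆? ⊤
      ... | yes _  = refl
      ... | no P⊈⊤ = contradiction (λ {y} → ⊆⊤ {p = P x} {y}) P⊈⊤
      sum-1 : ∀ m → sum {m} (const 1) ≡ m
      sum-1 zero    = refl
      sum-1 (suc m) = cong suc (sum-1 m)

    -- Induction on the number `d` of discarded cells, starting from `⊤` with equality. For t ≤ s,
    -- the ratio of `falling k t` to `falling s t` is the probability that a random set of `k` cells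
    -- contains a given set of `t` cells, so greedy removal matches the guarantee of a random
    -- choice.
    dense-cells : ∀ d → k + d ≡ s → ∃ λ T → ∣ T ∣ ≡ k × u * falling k t ≤ covered T * falling s t
    dense-cells {k} zero    eq = ⊤ , trans (∣⊤∣≡n s) (trans (sym eq) (+-identityʳ k)) ,
      ≤-reflexive (cong₂ (λ x y → x * falling y t) (sym covered-⊤) (trans (sym (+-identityʳ k)) eq))
    dense-cells {k} (suc d) eq with dense-cells {suc k} d (trans (sym (+-suc k d)) eq)
    ... | T , ∣T∣ , h with remove-cell T ∣T∣
    ... | T′ , ∣T′∣ , h′ = T′ , ∣T′∣ , *-cancelˡ-≤ (suc k) (begin
      suc k * (u * falling k t)                 ≡⟨ x∙yz≈y∙xz (suc k) u (falling k t) ⟩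
      u * (suc k * falling k t)                 ≡⟨ cong (u *_) (sym (falling-suc (suc k) t)) ⟩
      u * (falling (suc k) t * (suc k ∸ t))     ≡⟨ sym (*-assoc u _ _) ⟩
      u * falling (suc k) t * (suc k ∸ t)       ≤⟨ *-monoˡ-≤ (suc k ∸ t) h ⟩
      covered T * falling s t * (suc k ∸ t)     ≡⟨ xy∙z≈zx∙y (covered T) (falling s t) (suc k ∸ t) ⟩
      (suc k ∸ t) * covered T * falling s t     ≤⟨ *-monoˡ-≤ (falling s t) h′ ⟩
      suc k * covered T′ * falling s t          ≡⟨ *-assoc (suc k) (covered T′) (falling s t) ⟩
      suc k * (covered T′ * falling s t)        ∎)
      where
      open ≤-Reasoning

  -- Trade-off between probes and cells for a dictionary.

  module Dictionary (D : NonAdaptiveDictionary n u s w)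
    (queryTime : NonAdaptiveDictionary.QueryTime≤ D t) where

    open NonAdaptiveDictionary D
    open Covering probes t queryTime

    keys : Subset s → Subset u
    keys S = tabulate (λ x → does (probes x ⊆? S))

    ∣keys∣ : ∀ S → ∣ keys S ∣ ≡ covered S
    ∣keys∣ S = trans (∣p∣≡∑ (keys S)) (sum-cong-≗ {u} (λ x → cong 𝟙 (lookup∘tabulate (λ x → does (probes x ⊆? S)) x)))

    keys-⊆ : ∀ S {x} → x ∈ keys S → probes x ⊆ S
    keys-⊆ S {x} x∈ with probes x ⊆? S | trans (sym (lookup∘tabulate (λ x → does (probes x ⊆? S)) x)) ([]=⇒lookup x∈)
    ... | yes P⊆S | _ = P⊆S

    -- Otherwise `n` covered keys form `n` blocks of one key each, and their free values require
    -- `u ^ n` different contents of the cells in `S`.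
    few-keys : ∀ S → 2 ^ (∣ S ∣ * w) < u ^ n → covered S ≤ n
    few-keys S small with n ≤? covered S
    ... | no  n≰ = <⇒≤ (≰⇒> n≰)
    ... | yes n≤ = contradiction
      (subst (λ q → q ^ n ≤ _) (*-identityˡ u) (Capacity.capacity D S key
        (λ { {j = zero} {zero} eq → inject≤-injective n≤∣keys∣ n≤∣keys∣ _ _ (element-injective (keys S) eq) , refl })
        (λ i _ → keys-⊆ S (element-∈ (keys S) (inject≤ i n≤∣keys∣)))))
      (<⇒≱ small)
      where
      n≤∣keys∣ : n ≤ ∣ keys S ∣
      n≤∣keys∣ = subst (n ≤_) (sym (∣keys∣ S)) n≤
      key : Fin n → Fin 1 → Fin u
      key i _ = element (keys S) (inject≤ i n≤∣keys∣)

    u*falling≤ : ∀ k → k ≤ s → 2 ^ (k * w) < u ^ n → u * falling k t ≤ n * falling s t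
    u*falling≤ k k≤s small =
      let T , ∣T∣ , h = dense-cells {k} (s ∸ k) (m+[n∸m]≡n k≤s)
      in ≤-trans h (*-monoˡ-≤ (falling s t)
           (few-keys T (subst (λ k → 2 ^ (k * w) < u ^ n) (sym ∣T∣) small)))

    -- Substituting k = 4 (t + 1) + o makes both sides explicit. The successor of `t` matters: with
    -- no probes and k = 0 the inequality would read 1 ≤ 0.
    1+k≤2[k-t] : ∀ k t → 4 * suc t ≤ k → suc k ≤ 2 * (k ∸ suc t)
    1+k≤2[k-t] k t 4t≤k with m≤n⇒∃[o]m+o≡n 4t≤k
    ... | o , refl = begin
      suc (4 * suc t + o)                           ≤⟨ m≤m+n _ (1 + 2 * t + o) ⟩
      suc (4 * suc t + o) + (1 + 2 * t + o)         ≡⟨ solve 2 (λ t o →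
        con 1 :+ (con 4 :* (con 1 :+ t) :+ o) :+ (con 1 :+ con 2 :* t :+ o)
        := con 2 :* (con 3 :* (con 1 :+ t) :+ o)) refl t o ⟩
      2 * (3 * suc t + o)                           ≡⟨ cong (2 *_) (sym (m+n∸m≡n (suc t) _)) ⟩
      2 * (suc t + (3 * suc t + o) ∸ suc t)         ≡⟨ cong (λ k → 2 * (k ∸ suc t)) (sym (+-assoc (suc t) _ o)) ⟩
      2 * (4 * suc t + o ∸ suc t)                   ∎
      where
      open ≤-Reasoning
      open +-*-Solver

    -- As 4 t ≤ k, every factor of `falling k t` is at least (k + 1) / 2, while every factor of
    -- `falling s t` is at most s. So u / n ≤ (2 s / (k + 1))ᵗ.
    u*[1+k]^t≤ : ∀ k → k ≤ s → 2 ^ (k * w) < u ^ n → 4 * t ≤ k → u * suc k ^ t ≤ n * (2 * s) ^ t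
    u*[1+k]^t≤ k k≤s small 4t≤k = begin
      u * suc k ^ t                ≤⟨ *-monoʳ-≤ u (bound t 4t≤k) ⟩
      u * (2 ^ t * falling k t)    ≡⟨ x∙yz≈y∙xz u (2 ^ t) _ ⟩
      2 ^ t * (u * falling k t)    ≤⟨ *-monoʳ-≤ (2 ^ t) (u*falling≤ k k≤s small) ⟩
      2 ^ t * (n * falling s t)    ≡⟨ x∙yz≈y∙xz (2 ^ t) n _ ⟩
      n * (2 ^ t * falling s t)    ≤⟨ *-monoʳ-≤ n (*-monoʳ-≤ (2 ^ t) (falling≤^ s t)) ⟩
      n * (2 ^ t * s ^ t)          ≡⟨ cong (n *_) (sym (^-distribʳ-* t 2 s)) ⟩
      n * (2 * s) ^ t              ∎
      where
      open ≤-Reasoning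
      bound : ∀ t → 4 * t ≤ k → suc k ^ t ≤ 2 ^ t * falling k t
      bound zero    _    = ≤-refl
      bound t@(suc t-1) 4t≤k = begin
        suc k ^ t                  ≤⟨ ^-monoˡ-≤ t (1+k≤2[k-t] k t-1 4t≤k) ⟩
        (2 * (k ∸ t)) ^ t          ≡⟨ ^-distribʳ-* t 2 (k ∸ t) ⟩
        2 ^ t * (k ∸ t) ^ t        ≤⟨ *-monoʳ-≤ (2 ^ t) (^≤falling k t) ⟩
        2 ^ t * falling k t        ∎

  last-below : {P : ℕ → Set} → (∀ k → Dec (P k)) → P 0 → ∀ m → ¬ P m → ∃ λ k → k < m × P k × ¬ P (suc k)
  last-below P? p0 zero    ¬pm = contradiction p0 ¬pm
  last-below P? p0 (suc m) ¬pm with P? m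
  ... | yes pm  = m , ≤-refl , pm , ¬pm
  ... | no  ¬pm′ = let k , k<m , pk , ¬psk = last-below P? p0 m ¬pm′
                  in k , m<n⇒m<1+n k<m , pk , ¬psk

  -- `k` is where the condition k w < n L, written `2 ^ (k * w) * n ^ n < u ^ n`, turns from true to
  -- false: it holds at 0 since n < u, and fails at `s` by `memory-bound`.
  threshold : (D : NonAdaptiveDictionary n u s w) → NonAdaptiveDictionary.QueryTime≤ D t →
              1 ≤ n → n < u → ∃ λ k → u ^ n ≤ 2 ^ (suc k * w) * n ^ n ×
              (4 * t ≤ k → u * suc k ^ t ≤ n * (2 * s) ^ t)
  threshold {n} {u} {s} {w} {t} D queryTime 1≤n n<u = conclude (last-below
    (λ k → 2 ^ (k * w) * n ^ n <? u ^ n)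
    (subst (_< u ^ n) (sym (*-identityˡ (n ^ n))) (^-monoˡ-< n n<u)) s (≤⇒≯ uⁿ≤2ˢʷnⁿ))
    where
    open ≤-Reasoning
    instance
      n≢0 : NonZero n
      n≢0 = >-nonZero 1≤n
      u≢0 : NonZero u
      u≢0 = >-nonZero (m<n⇒0<n n<u)
    conclude : (∃ λ k → k < s × 2 ^ (k * w) * n ^ n < u ^ n × ¬ (2 ^ (suc k * w) * n ^ n < u ^ n)) →
               ∃ λ k → u ^ n ≤ 2 ^ (suc k * w) * n ^ n ×
               (4 * t ≤ k → u * suc k ^ t ≤ n * (2 * s) ^ t)
    conclude (k , k<s , below , ¬below) = k , ≮⇒≥ ¬below ,
      Dictionary.u*[1+k]^t≤ D queryTime k (<⇒≤ k<s)
        (≤-<-trans (m≤m*n (2 ^ (k * w)) (n ^ n) {{m^n≢0 n n}}) below)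
    -- One of the two factors n in `memory-bound` is enlarged to u and then cancelled.
    uⁿ≤2ˢʷnⁿ : u ^ n ≤ 2 ^ (s * w) * n ^ n
    uⁿ≤2ˢʷnⁿ = *-cancelʳ-≤ (u ^ n) (2 ^ (s * w) * n ^ n) (u ^ n) {{m^n≢0 u n}} (begin
      u ^ n * u ^ n                      ≡⟨ sym (^-distribʳ-* n u u) ⟩
      (u * u) ^ n                        ≤⟨ memory-bound D 1≤n n<u ⟩
      2 ^ (s * w) * (n * n) ^ n          ≤⟨ *-monoʳ-≤ (2 ^ (s * w)) (^-monoˡ-≤ n (*-monoʳ-≤ n (<⇒≤ n<u))) ⟩
      2 ^ (s * w) * (n * u) ^ n          ≡⟨ cong (2 ^ (s * w) *_) (^-distribʳ-* n n u) ⟩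
      2 ^ (s * w) * (n ^ n * u ^ n)      ≡⟨ sym (*-assoc (2 ^ (s * w)) (n ^ n) (u ^ n)) ⟩
      2 ^ (s * w) * n ^ n * u ^ n        ∎)

module Logarithms where

  open import Algebra.Bundles using (CommutativeRing)
  import Algebra.Properties.CommutativeSemiring.Exp as Exp
  open import Data.Integer.Base as ℤ using (_⊖_)
  import Data.Integer.Properties as ℤ
  open import Data.Integer.Solver using () renaming (module +-*-Solver to ℤ-Solver)
  open import Data.Nat.Base as ℕ using (ℕ; zero; suc; NonZero)
  import Data.Nat.Properties as ℕ
  open import Data.Product.Base using (∃; ∃₂; _×_; _,_)
  open import Data.Rational.Base as ℚ using (ℚ; 0ℚ; 1ℚ; ½; _+_; _*_; -_; _-_; _<_; _≤_)
  import Data.Rational.Properties as ℚ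
  open import Data.Rational.Solver using (module +-*-Solver)
  import Data.Rational.Unnormalised.Base as ℚᵘ
  import Data.Rational.Unnormalised.Properties as ℚᵘ
  open import Data.Sum.Base using (inj₁; inj₂)
  open import Relation.Binary.PropositionalEquality
  open import Relation.Nullary.Decidable.Core using (Dec; yes; no)
  open import Relation.Nullary.Negation.Core using (¬_; contradiction)
  open import Defs
  open Counting using (memory-bound; threshold)
  open RationalLemmas
  open ℝ
  open ℝ⁺
  open PositiveLemmas using (upper⇒pos)
  open Exp (CommutativeRing.commutativeSemiring ℚ.+-*-commutativeRing)
    using (_^_; ^-assocʳ; ^-distrib-*)
  open import Algebra.Properties.CommutativeSemigroup
    (CommutativeRing.*-commutativeSemigroup ℚ.+-*-commutativeRing)
    using (x∙yz≈y∙xz)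

  -- Rational bounds for quotients and logarithms of cuts.

  <⇒≱ : ∀ {p q} → p < q → ¬ q ≤ p
  <⇒≱ p<q q≤p = ℚ.<-irrefl refl (ℚ.<-≤-trans p<q q≤p)

  fromℕ-+ : ∀ m n → fromℕ (m ℕ.+ n) ≡ fromℕ m + fromℕ n
  fromℕ-+ zero    n = sym (ℚ.+-identityˡ (fromℕ n))
  fromℕ-+ (suc m) n = trans (fromℕ-suc (m ℕ.+ n)) (trans (cong (1ℚ +_) (fromℕ-+ m n))
    (trans (sym (ℚ.+-assoc 1ℚ (fromℕ m) (fromℕ n))) (cong (_+ fromℕ n) (sym (fromℕ-suc m)))))

  fromℕ-* : ∀ m n → fromℕ (m ℕ.* n) ≡ fromℕ m * fromℕ n
  fromℕ-* zero    n = sym (ℚ.*-zeroˡ (fromℕ n))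
  fromℕ-* (suc m) n = trans (fromℕ-+ n (m ℕ.* n)) (trans (cong (fromℕ n +_) (fromℕ-* m n))
    (trans (distrib (fromℕ m) (fromℕ n)) (cong (_* fromℕ n) (sym (fromℕ-suc m)))))
    where
    open +-*-Solver
    distrib : ∀ p q → q + p * q ≡ (1ℚ + p) * q
    distrib = solve 2 (λ p q → q :+ p :* q := (con 1ℚ :+ p) :* q) refl

  fromℕ-^ : ∀ m n → fromℕ (m ℕ.^ n) ≡ fromℕ m ^ n
  fromℕ-^ m zero    = refl
  fromℕ-^ m (suc n) = trans (fromℕ-* m (m ℕ.^ n)) (cong (fromℕ m *_) (fromℕ-^ m n))

  ⊖/-* : ∀ m n b .{{_ : NonZero b}} → ((m ⊖ n) ℚ./ b) * fromℕ b ≡ fromℕ m - fromℕ n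
  ⊖/-* m n b@(suc b-1) = ℚ.toℚᵘ-injective (begin
    ℚ.toℚᵘ (((m ⊖ n) ℚ./ b) * fromℕ b)                 ≈⟨ ℚ.toℚᵘ-homo-* ((m ⊖ n) ℚ./ b) (fromℕ b) ⟩
    ℚ.toℚᵘ ((m ⊖ n) ℚ./ b) ℚᵘ.* ℚ.toℚᵘ (fromℕ b)       ≈⟨ ℚᵘ.*-congʳ (ℚ.toℚᵘ-fromℚᵘ (ℚᵘ.mkℚᵘ (m ⊖ n) b-1)) ⟩
    ℚᵘ.mkℚᵘ (m ⊖ n) b-1 ℚᵘ.* ℚᵘ.mkℚᵘ (ℤ.+ b) 0         ≈⟨ ℚᵘ.*≡* cleared ⟩
    ℚᵘ.mkℚᵘ (ℤ.+ m) 0 ℚᵘ.+ ℚᵘ.- ℚᵘ.mkℚᵘ (ℤ.+ n) 0      ≈⟨ ℚᵘ.+-congʳ (ℚ.toℚᵘ (fromℕ m)) (ℚᵘ.≃-sym (ℚ.toℚᵘ-homo‿- (fromℕ n))) ⟩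
    ℚ.toℚᵘ (fromℕ m) ℚᵘ.+ ℚ.toℚᵘ (- fromℕ n)           ≈⟨ ℚᵘ.≃-sym (ℚ.toℚᵘ-homo-+ (fromℕ m) (- fromℕ n)) ⟩
    ℚ.toℚᵘ (fromℕ m - fromℕ n)                         ∎)
    where
    open ℚᵘ.≃-Reasoning
    cleared : ((m ⊖ n) ℤ.* ℤ.+ b) ℤ.* ℤ.+ 1 ≡ (ℤ.+ m ℤ.* ℤ.+ 1 ℤ.+ ℤ.- (ℤ.+ n) ℤ.* ℤ.+ 1) ℤ.* ℤ.+ (b ℕ.* 1)
    cleared = trans
      (cong (λ i → (i ℤ.* ℤ.+ b) ℤ.* ℤ.+ 1) (sym (ℤ.m-n≡m⊖n m n)))
      (trans (eq (ℤ.+ m) (ℤ.+ n) (ℤ.+ b))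
        (cong (λ b → (ℤ.+ m ℤ.* ℤ.+ 1 ℤ.+ ℤ.- (ℤ.+ n) ℤ.* ℤ.+ 1) ℤ.* ℤ.+ b) (sym (ℕ.*-identityʳ b))))
      where
      open ℤ-Solver
      eq : ∀ m n b → ((m ℤ.- n) ℤ.* b) ℤ.* ℤ.+ 1 ≡ (m ℤ.* ℤ.+ 1 ℤ.+ ℤ.- n ℤ.* ℤ.+ 1) ℤ.* b
      eq = solve 3 (λ m n b → ((m :- n) :* b) :* con (ℤ.+ 1)
        := (m :* con (ℤ.+ 1) :+ (:- n) :* con (ℤ.+ 1)) :* b) refl

  -- The comparison is made through a rational y strictly between two rationals below x,
  -- since the two sides of the cut of lg y are disjoint.
  lg-upper : ∀ x {q} m n b .{{_ : NonZero b}} → lower (lg x) q →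
             (∀ r → 0ℚ < r → lower (real x) r → 2ℚ ^ n * r ^ b ≤ 2ℚ ^ m) →
             q * fromℕ b ≤ fromℕ m - fromℕ n
  lg-upper x {q} m n b@(suc _) q<lgx bound = ℚ.≮⇒≥ λ m-n<qb →
    let open _<lg_ q<lgx using (r; 0<r; r<x; b≢0; 2ᵐ≤2ⁿrᵇ; q<[m-n]/b) renaming (m to m₁; n to n₁; b to b₁)
        y , r<y , y<x = lower-open (real x) r<x
        z , y<z , z<x = lower-open (real x) y<x
        y⁺            = fromℚ y ,⁺ ℚ.<-trans 0<r r<y
        q<lgy         = record
          { m = m₁ ; n = n₁ ; b = b₁ ; r = r ; 0<r = 0<r ; r<x = r<y
          ; 2ᵐ≤2ⁿrᵇ = 2ᵐ≤2ⁿrᵇ ; q<[m-n]/b = q<[m-n]/b }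
        q>lgy : q >lg y⁺
        q>lgy = record
          { m = m ; n = n ; b = b ; r = z ; x<r = y<z
          ; 2ⁿrᵇ≤2ᵐ = bound z (ℚ.<-trans 0<r (ℚ.<-trans r<y y<z)) z<x
          ; [m-n]/b<q = *-cancelʳ-< (fromℕ-pos b) (subst (_< q * fromℕ b) (sym (⊖/-* m n b)) m-n<qb) }
    in disjoint (lg y⁺) {q} q<lgy q>lgy

  -- Locatedness is applied between `p` and some r < q; such an r cannot lie above `x`, since then q
  -- ≤ r.
  ≤⇒lower : ∀ x {p q} → (∀ r → upper x r → q ≤ r) → p < q → lower x p
  ≤⇒lower x bound p<q with ℚ.<-dense p<q
  ... | r , p<r , r<q with located x p<r
  ... | inj₁ p<x = p<x
  ... | inj₂ x<r = contradiction (bound r x<r) (<⇒≱ r<q)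

  *-cancelʳ-≤ : ∀ {p q r} → 0ℚ < r → p * r ≤ q * r → p ≤ q
  *-cancelʳ-≤ 0<r pr≤qr = ℚ.≮⇒≥ λ q<p → <⇒≱ (*-monoˡ-< 0<r q<p) pr≤qr

  -- The rational `b` below 1 / y is traded for a `c` above y with `b * c < 1`, so that q c < a b c
  -- < a.
  ÷-lower : ∀ x y {q} → lower (real (x ÷⁺ y)) q → ∃₂ λ a c → lower (real x) a × upper (real y) c × q * c < a
  ÷-lower x y {q} (a , b , 0<a , 0<b , a<x , (c , y<c , bc<1) , q<ab) = a , c , a<x , y<c , (begin-strict
    q * c          <⟨ *-monoˡ-< (upper⇒pos y y<c) q<ab ⟩
    a * b * c      ≡⟨ ℚ.*-assoc a b c ⟩
    a * (b * c)    <⟨ *-monoʳ-< 0<a bc<1 ⟩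
    a * 1ℚ         ≡⟨ ℚ.*-identityʳ a ⟩
    a              ∎)
    where open ℚ.≤-Reasoning

  ÷-upper : ∀ x y {q} → upper (real (x ÷⁺ y)) q →
            ∃₂ λ a d → upper (real x) a × 0ℚ < d × lower (real y) d × a < q * d
  ÷-upper x y {q} (a , b , x<a , (d , 0<d , d<y , 1<bd) , ab<q) = a , d , x<a , 0<d , d<y , (begin-strict
    a              ≡⟨ sym (ℚ.*-identityʳ a) ⟩
    a * 1ℚ         <⟨ *-monoʳ-< (upper⇒pos x x<a) 1<bd ⟩
    a * (b * d)    ≡⟨ sym (ℚ.*-assoc a b d) ⟩
    a * b * d      <⟨ *-monoˡ-< 0<d ab<q ⟩
    q * d          ∎)
    where open ℚ.≤-Reasoning

  ι*ι-upper : ∀ {m n} (0<m : 0 ℕ.< m) (0<n : 0 ℕ.< n) {q} →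
              upper (real (ι⁺ m 0<m *⁺ ι⁺ n 0<n)) q → fromℕ (m ℕ.* n) < q
  ι*ι-upper {m} {n} 0<m 0<n {q} (a , b , m<a , n<b , ab<q) = subst (_< q) (sym (fromℕ-* m n))
    (ℚ.<-trans (*-mono-< (fromℕ-mono-< 0<m) (ℚ.<-trans (fromℕ-mono-< 0<n) n<b) m<a n<b) ab<q)

  ÷-upper-bound : ∀ x y {p j k} → 0ℚ < j → (∀ {q} → upper (real x) q → p < q) →
                  (∀ {q} → lower (real y) q → q * j ≤ k) →
                  ∀ {q} → upper (real (x ÷⁺ y)) q → p * j < q * k
  ÷-upper-bound x y {p} {j} {k} 0<j p<x yj≤k {q} x÷y<q with ÷-upper x y {q} x÷y<q
  ... | a , d , x<a , 0<d , d<y , a<qd = begin-strict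
    p * j          <⟨ *-monoˡ-< 0<j (ℚ.<-trans (p<x x<a) a<qd) ⟩
    q * d * j      ≡⟨ ℚ.*-assoc q d j ⟩
    q * (d * j)    ≤⟨ *-monoʳ-≤ (ℚ.<⇒≤ (upper⇒pos (x ÷⁺ y) {q} x÷y<q)) (yj≤k d<y) ⟩
    q * k          ∎
    where open ℚ.≤-Reasoning

  ÷ι-lower : ∀ x {n} (0<n : 0 ℕ.< n) {q} → 0ℚ < q → lower (real (x ÷⁺ ι⁺ n 0<n)) q →
             ∃ λ a → lower (real x) a × q * fromℕ n < a
  ÷ι-lower x {n} 0<n {q} 0<q q<x÷n with ÷-lower x (ι⁺ n 0<n) {q} q<x÷n
  ... | a , c , a<x , n<c , qc<a = a , a<x , ℚ.<-trans (*-monoʳ-< 0<q n<c) qc<a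

  -- The witness for lg y < q is an inequality `2ℚ ^ n * R ^ b ≤ 2ℚ ^ m`. Its `j`-th power bounds
  -- `2ℚ ^ (n ℕ.* j) * r ^ b`, so `lg-upper` applies with both exponents of 2 multiplied by `j` and
  -- the same `b`.
  lg-power : ∀ x y j {p q} → lower (lg x) p → upper (lg y) q →
             (∀ r R → 0ℚ < r → lower (real x) r → upper (real y) R → r ≤ R ^ j) →
             p ≤ fromℕ j * q
  lg-power x y j {p} {q} p<lgx lgy<q bound = *-cancelʳ-≤ (fromℕ-pos b) (begin
    p * fromℕ b                              ≤⟨ lg-upper x (m ℕ.* j) (n ℕ.* j) b p<lgx powers ⟩
    fromℕ (m ℕ.* j) - fromℕ (n ℕ.* j)        ≡⟨ cong₂ _-_ (fromℕ-* m j) (fromℕ-* n j) ⟩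
    fromℕ m * fromℕ j - fromℕ n * fromℕ j    ≡⟨ factor (fromℕ m) (fromℕ n) (fromℕ j) ⟩
    fromℕ j * (fromℕ m - fromℕ n)            ≡⟨ cong (fromℕ j *_) (sym (⊖/-* m n b)) ⟩
    fromℕ j * (((m ⊖ n) ℚ./ b) * fromℕ b)    ≤⟨ *-monoʳ-≤ (fromℕ-nonNeg j) (*-monoˡ-≤ (fromℕ-nonNeg b) (ℚ.<⇒≤ [m-n]/b<q)) ⟩
    fromℕ j * (q * fromℕ b)                  ≡⟨ sym (ℚ.*-assoc (fromℕ j) q (fromℕ b)) ⟩
    fromℕ j * q * fromℕ b                    ∎)
    where
    open ℚ.≤-Reasoning
    open _>lg_ lgy<q renaming (r to R; x<r to y<R)
    factor : ∀ x y z → x * z - y * z ≡ z * (x - y)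
    factor = solve 3 (λ x y z → x :* z :- y :* z := z :* (x :- y)) refl
      where open +-*-Solver
    powers : ∀ r → 0ℚ < r → lower (real x) r → 2ℚ ^ (n ℕ.* j) * r ^ b ≤ 2ℚ ^ (m ℕ.* j)
    powers r 0<r r<x = begin
      2ℚ ^ (n ℕ.* j) * r ^ b           ≤⟨ *-monoʳ-≤ (ℚ.<⇒≤ (^-pos 0<2 (n ℕ.* j))) (^-monoˡ-≤ 0<r (bound r R 0<r r<x y<R) b) ⟩
      2ℚ ^ (n ℕ.* j) * (R ^ j) ^ b     ≡⟨ cong₂ _*_ (sym (^-assocʳ 2ℚ n j))
        (trans (^-assocʳ R j b) (trans (cong (R ^_) (ℕ.*-comm j b)) (sym (^-assocʳ R b j)))) ⟩
      (2ℚ ^ n) ^ j * (R ^ b) ^ j       ≡⟨ sym (^-distrib-* (2ℚ ^ n) (R ^ b) j) ⟩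
      (2ℚ ^ n * R ^ b) ^ j             ≤⟨ ^-monoˡ-≤ (*-pos (^-pos 0<2 n) (^-pos (upper⇒pos y y<R) b)) 2ⁿrᵇ≤2ᵐ j ⟩
      (2ℚ ^ m) ^ j                     ≡⟨ ^-assocʳ 2ℚ m j ⟩
      2ℚ ^ (m ℕ.* j)                   ∎

  -- Integer inequalities read as bounds on L and r.

  u/n-lower : ∀ {u n} (0<u : 0 ℕ.< u) (0<n : 0 ℕ.< n) {r} → 0ℚ < r →
              lower (real (ι⁺ u 0<u ÷⁺ ι⁺ n 0<n)) r → r * fromℕ n ≤ fromℕ u
  u/n-lower {u} 0<u 0<n {r} 0<r r<u/n =
    let a , a<u , rn<a = ÷ι-lower (ι⁺ u 0<u) 0<n {r} 0<r r<u/n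
    in ℚ.<⇒≤ (ℚ.<-trans rn<a a<u)

  -- x is u / n, and in Bound ρ is s w / (n lg x).  They are parameters because comparing named
  -- reals unfolds their whole cuts, proofs included, which is prohibitively slow.
  module Ratio {n u : ℕ} (0<n : 0 ℕ.< n) (x : ℝ⁺) (1<x : 1⁺ <⁺ x)
    (x≤u/n : ∀ {r} → 0ℚ < r → lower (real x) r → r * fromℕ n ≤ fromℕ u) where

    -- The hypothesis says (u / n)ᴶ ≤ 2ᴷ, which is the case of `lg-upper` for the fraction (K - 0) /
    -- J.
    lg-bound : ∀ J K .{{_ : NonZero J}} → u ℕ.^ J ℕ.≤ 2 ℕ.^ K ℕ.* n ℕ.^ J →
             ∀ {q} → lower (real (lg⁺ x 1<x)) q → q * fromℕ J ≤ fromℕ K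
    lg-bound J K uᴶ≤2ᴷnᴶ {q} q<lg =
      subst (q * fromℕ J ≤_) (ℚ.+-identityʳ (fromℕ K)) (lg-upper x K 0 J q<lg powers)
      where
      open ℚ.≤-Reasoning
      0<n′ : 0ℚ < fromℕ n
      0<n′ = fromℕ-mono-< 0<n
      powers : ∀ r → 0ℚ < r → lower (real x) r → 1ℚ * r ^ J ≤ 2ℚ ^ K
      powers r 0<r r<x = *-cancelʳ-≤ (^-pos 0<n′ J) (begin
        1ℚ * r ^ J * fromℕ n ^ J        ≡⟨ cong (_* fromℕ n ^ J) (ℚ.*-identityˡ (r ^ J)) ⟩
        r ^ J * fromℕ n ^ J             ≡⟨ sym (^-distrib-* r (fromℕ n) J) ⟩
        (r * fromℕ n) ^ J               ≤⟨ ^-monoˡ-≤ (*-pos 0<r 0<n′) (x≤u/n {r} 0<r r<x) J ⟩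
        fromℕ u ^ J                     ≡⟨ sym (fromℕ-^ u J) ⟩
        fromℕ (u ℕ.^ J)                 ≤⟨ fromℕ-mono-≤ uᴶ≤2ᴷnᴶ ⟩
        fromℕ (2 ℕ.^ K ℕ.* n ℕ.^ J)     ≡⟨ trans (fromℕ-* (2 ℕ.^ K) (n ℕ.^ J)) (cong₂ _*_ (fromℕ-^ 2 K) (fromℕ-^ n J)) ⟩
        2ℚ ^ K * fromℕ n ^ J            ∎)

    -- J = n j in `lg-bound` gives n L ≤ K / j. The bound for the whole memory will use j = 2, the
    -- threshold `k` will use j = 1.
    n·lg-bound : ∀ j K .{{_ : NonZero j}} → u ℕ.^ (n ℕ.* j) ℕ.≤ 2 ℕ.^ K ℕ.* n ℕ.^ (n ℕ.* j) →
               ∀ {q} → lower (real (ι⁺ n 0<n *⁺ lg⁺ x 1<x)) q → q * fromℕ j ≤ fromℕ K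
    n·lg-bound j K h {q} (a , ℓ , 0<a , 0<ℓ , a<n , ℓ<lg , q<aℓ) = begin
      q * fromℕ j                ≤⟨ *-monoˡ-≤ (fromℕ-nonNeg j) (ℚ.<⇒≤ q<aℓ) ⟩
      a * ℓ * fromℕ j            ≤⟨ *-monoˡ-≤ (fromℕ-nonNeg j) (*-monoˡ-≤ (ℚ.<⇒≤ 0<ℓ) (ℚ.<⇒≤ a<n)) ⟩
      fromℕ n * ℓ * fromℕ j      ≡⟨ trans (cong (_* fromℕ j) (ℚ.*-comm (fromℕ n) ℓ)) (ℚ.*-assoc ℓ (fromℕ n) (fromℕ j)) ⟩
      ℓ * (fromℕ n * fromℕ j)    ≡⟨ cong (ℓ *_) (sym (fromℕ-* n j)) ⟩
      ℓ * fromℕ (n ℕ.* j)        ≤⟨ lg-bound (n ℕ.* j) K {{ℕ.m*n≢0 n j {{ℕ.>-nonZero 0<n}}}} h ℓ<lg ⟩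
      fromℕ K                    ∎
      where open ℚ.≤-Reasoning

    ρ-bound : ∀ {s w} (0<s : 0 ℕ.< s) (0<w : 0 ℕ.< w) j K .{{_ : NonZero j}} →
              u ℕ.^ (n ℕ.* j) ℕ.≤ 2 ℕ.^ K ℕ.* n ℕ.^ (n ℕ.* j) →
              ∀ {R} → upper (real ((ι⁺ s 0<s *⁺ ι⁺ w 0<w) ÷⁺ (ι⁺ n 0<n *⁺ lg⁺ x 1<x))) R →
              fromℕ (s ℕ.* w) * fromℕ j < R * fromℕ K
    ρ-bound {s} {w} 0<s 0<w j K h {R} = ÷-upper-bound (ι⁺ s 0<s *⁺ ι⁺ w 0<w) (ι⁺ n 0<n *⁺ lg⁺ x 1<x)
      (fromℕ-pos j) (λ {a} → ι*ι-upper 0<s 0<w {a}) (λ {d} → n·lg-bound j K h {d}) {R}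

  -- The constant of the theorem. It cancels the 4 of `min≤4t`, which stems from the condition 4 t ≤
  -- k that keeps k - t above (k + 1) / 2 when t > 0.
  ¼⁺ : ℝ⁺
  ¼⁺ = fromℚ (½ * ½) ,⁺ *-pos {½} {½} 0<½ 0<½
    where
    0<½ : 0ℚ < ½
    0<½ = ℚ.positive⁻¹ ½

  quarter : ∀ q a b t → q < a * b → a < ½ * ½ → 0ℚ < b → b ≤ fromℕ (4 ℕ.* t) → q < fromℕ t
  quarter q a b t q<ab a<¼ 0<b b≤4t = begin-strict
    q                                <⟨ q<ab ⟩
    a * b                            <⟨ *-monoˡ-< 0<b a<¼ ⟩
    ½ * ½ * b                        ≤⟨ *-monoʳ-≤ (ℚ.<⇒≤ (positive ¼⁺)) b≤4t ⟩
    ½ * ½ * fromℕ (4 ℕ.* t)          ≡⟨ cong (½ * ½ *_) (fromℕ-* 4 t) ⟩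
    ½ * ½ * (fromℕ 4 * fromℕ t)      ≡⟨ sym (ℚ.*-assoc (½ * ½) (fromℕ 4) (fromℕ t)) ⟩
    ½ * ½ * fromℕ 4 * fromℕ t        ≡⟨ ℚ.*-identityˡ (fromℕ t) ⟩
    fromℕ t                          ∎
    where open ℚ.≤-Reasoning

  -- The two regimes of the lower bound.

  module Bound {n u s w t : ℕ} (1≤n : 1 ℕ.≤ n) (n<u : n ℕ.< u) (1≤s : 1 ℕ.≤ s) (1≤w : 1 ℕ.≤ w)
    (D : NonAdaptiveDictionary n u s w) (queryTime : NonAdaptiveDictionary.QueryTime≤ D t)
    (x : ℝ⁺) (1<x : 1⁺ <⁺ x)
    (x≤u/n : ∀ {r} → 0ℚ < r → lower (real x) r → r * fromℕ n ≤ fromℕ u)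
    (ρ : ℝ⁺)
    (ρ-bound : ∀ j K .{{_ : NonZero j}} → u ℕ.^ (n ℕ.* j) ℕ.≤ 2 ℕ.^ K ℕ.* n ℕ.^ (n ℕ.* j) →
               ∀ {R} → upper (real ρ) R → fromℕ (s ℕ.* w) * fromℕ j < R * fromℕ K) where

    open Ratio 1≤n x 1<x x≤u/n using (n·lg-bound)

    0<w : 0ℚ < fromℕ w
    0<w = fromℕ-mono-< 1≤w

    -- Since 2 n L ≤ s w by `memory-bound`, `ρ-bound` applies with j = 2 and K = s w, and s w
    -- cancels. This makes lg ρ positive and later absorbs the 2 in 2 s / (k + 1).
    2<ρ : ∀ {R} → upper (real ρ) R → 2ℚ < R
    2<ρ {R} ρ<R = *-cancelʳ-< 0<sw
      (subst (_< R * fromℕ (s ℕ.* w)) (ℚ.*-comm (fromℕ (s ℕ.* w)) 2ℚ) (ρ-bound 2 (s ℕ.* w) squares {R} ρ<R))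
      where
      0<sw : 0ℚ < fromℕ (s ℕ.* w)
      0<sw = fromℕ-mono-< (ℕ.*-mono-≤ 1≤s 1≤w)
      square : ∀ m → (m ℕ.* m) ℕ.^ n ≡ m ℕ.^ (n ℕ.* 2)
      square m = trans (cong (ℕ._^ n) (cong (m ℕ.*_) (sym (ℕ.*-identityʳ m))))
        (trans (ℕ.^-*-assoc m 2 n) (cong (m ℕ.^_) (ℕ.*-comm 2 n)))
      squares : u ℕ.^ (n ℕ.* 2) ℕ.≤ 2 ℕ.^ (s ℕ.* w) ℕ.* n ℕ.^ (n ℕ.* 2)
      squares = subst₂ (λ x y → x ℕ.≤ 2 ℕ.^ (s ℕ.* w) ℕ.* y) (square u) (square n) (memory-bound D 1≤n n<u)

    1<ρ : 1⁺ <⁺ ρ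
    1<ρ = let q , 1<q , q<2 = ℚ.<-dense (fromℕ-mono-< {1} {2} ℕ.≤-refl)
          in q , 1<q , ≤⇒lower (real ρ) {q} {2ℚ} (λ R ρ<R → ℚ.<⇒≤ (2<ρ {R} ρ<R)) q<2

    module Threshold (k : ℕ) (uⁿ≤ : u ℕ.^ n ℕ.≤ 2 ℕ.^ (suc k ℕ.* w) ℕ.* n ℕ.^ n)
      (dense : 4 ℕ.* t ℕ.≤ k → u ℕ.* suc k ℕ.^ t ℕ.≤ n ℕ.* (2 ℕ.* s) ℕ.^ t) where

      uⁿ≤′ : u ℕ.^ (n ℕ.* 1) ℕ.≤ 2 ℕ.^ (suc k ℕ.* w) ℕ.* n ℕ.^ (n ℕ.* 1)
      uⁿ≤′ = subst (λ m → u ℕ.^ m ℕ.≤ 2 ℕ.^ (suc k ℕ.* w) ℕ.* n ℕ.^ m) (sym (ℕ.*-identityʳ n)) uⁿ≤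

      n·lg≤ : ∀ {q} → lower (real (ι⁺ n 1≤n *⁺ lg⁺ x 1<x)) q → q ≤ fromℕ (suc k) * fromℕ w
      n·lg≤ {q} q<nlg = subst₂ _≤_ (ℚ.*-identityʳ q) (fromℕ-* (suc k) w)
        (n·lg-bound 1 (suc k ℕ.* w) uⁿ≤′ {q} q<nlg)

      -- The denominator n L of ρ is at most (k + 1) w, and `w` cancels.
      s<ρ[1+k] : ∀ {R} → upper (real ρ) R → fromℕ s < R * fromℕ (suc k)
      s<ρ[1+k] {R} ρ<R = *-cancelʳ-< 0<w (subst₂ _<_
        (trans (ℚ.*-identityʳ (fromℕ (s ℕ.* w))) (fromℕ-* s w))
        (trans (cong (R *_) (fromℕ-* (suc k) w)) (sym (ℚ.*-assoc R (fromℕ (suc k)) (fromℕ w))))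
        (ρ-bound 1 (suc k ℕ.* w) uⁿ≤′ {R} ρ<R))

      x≤ρ^2t : 4 ℕ.* t ℕ.≤ k → ∀ r R → 0ℚ < r → lower (real x) r → upper (real ρ) R → r ≤ R ^ (2 ℕ.* t)
      x≤ρ^2t 4t≤k r R 0<r r<x ρ<R = *-cancelʳ-≤ (*-pos 0<n (^-pos 0<K t)) (begin
        r * (fromℕ n * K ^ t)               ≡⟨ sym (ℚ.*-assoc r (fromℕ n) (K ^ t)) ⟩
        r * fromℕ n * K ^ t                 ≤⟨ *-monoˡ-≤ (ℚ.<⇒≤ (^-pos 0<K t)) (x≤u/n {r} 0<r r<x) ⟩
        fromℕ u * K ^ t                     ≡⟨ sym (trans (fromℕ-* u (suc k ℕ.^ t)) (cong (fromℕ u *_) (fromℕ-^ (suc k) t))) ⟩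
        fromℕ (u ℕ.* suc k ℕ.^ t)           ≤⟨ fromℕ-mono-≤ (dense 4t≤k) ⟩
        fromℕ (n ℕ.* (2 ℕ.* s) ℕ.^ t)       ≡⟨ trans (fromℕ-* n ((2 ℕ.* s) ℕ.^ t))
          (cong (fromℕ n *_) (trans (fromℕ-^ (2 ℕ.* s) t) (cong (_^ t) (fromℕ-* 2 s)))) ⟩
        fromℕ n * (2ℚ * fromℕ s) ^ t        ≤⟨ *-monoʳ-≤ (ℚ.<⇒≤ 0<n) (^-monoˡ-≤ (*-pos 0<2 (fromℕ-mono-< 1≤s)) 2s≤R²K t) ⟩
        fromℕ n * (R ^ 2 * K) ^ t           ≡⟨ cong (fromℕ n *_) (trans (^-distrib-* (R ^ 2) K t) (cong (_* K ^ t) (^-assocʳ R 2 t))) ⟩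
        fromℕ n * (R ^ (2 ℕ.* t) * K ^ t)   ≡⟨ x∙yz≈y∙xz (fromℕ n) (R ^ (2 ℕ.* t)) (K ^ t) ⟩
        R ^ (2 ℕ.* t) * (fromℕ n * K ^ t)   ∎)
        where
        open ℚ.≤-Reasoning
        K : ℚ
        K = fromℕ (suc k)
        0<K : 0ℚ < K
        0<K = fromℕ-pos (suc k)
        0<n : 0ℚ < fromℕ n
        0<n = fromℕ-mono-< 1≤n
        0<R : 0ℚ < R
        0<R = upper⇒pos ρ {R} ρ<R
        -- One factor `R` pays for the 2, the other for s / (k + 1); hence the exponent 2 t.
        2s≤R²K : 2ℚ * fromℕ s ≤ R ^ 2 * K
        2s≤R²K = subst (2ℚ * fromℕ s ≤_)
          (trans (sym (ℚ.*-assoc R R K)) (cong (λ z → R * z * K) (sym (ℚ.*-identityʳ R))))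
          (ℚ.<⇒≤ (*-mono-< 0<2 (*-pos 0<R 0<K) (2<ρ {R} ρ<R) (s<ρ[1+k] {R} ρ<R)))

      min≤4t : ∀ {b} → 0ℚ < b → lower (real ((ι⁺ n 1≤n *⁺ lg⁺ x 1<x) ÷⁺ ι⁺ w 1≤w)) b →
               lower (real (lg⁺ x 1<x ÷⁺ lg⁺ ρ 1<ρ)) b → b ≤ fromℕ (4 ℕ.* t)
      min≤4t {b} 0<b b<nlg/w b<lg/lg = cases (4 ℕ.* t ℕ.≤? k)
        where
        b≤1+k : b ≤ fromℕ (suc k)
        b≤1+k =
          let a , a<nlg , bw<a = ÷ι-lower (ι⁺ n 1≤n *⁺ lg⁺ x 1<x) 1≤w {b} 0<b b<nlg/w
          in *-cancelʳ-≤ 0<w (ℚ.<⇒≤ (ℚ.<-≤-trans bw<a (n·lg≤ {a} a<nlg)))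
        b≤2t : 4 ℕ.* t ℕ.≤ k → b ≤ fromℕ (2 ℕ.* t)
        b≤2t 4t≤k =
          let ℓ , σ , ℓ<lg , lg<σ , bσ<ℓ = ÷-lower (lg⁺ x 1<x) (lg⁺ ρ 1<ρ) {b} b<lg/lg
          in *-cancelʳ-≤ (upper⇒pos (lg⁺ ρ 1<ρ) {σ} lg<σ)
               (ℚ.<⇒≤ (ℚ.<-≤-trans bσ<ℓ (lg-power x ρ (2 ℕ.* t) {ℓ} {σ} ℓ<lg lg<σ (x≤ρ^2t 4t≤k))))
        cases : Dec (4 ℕ.* t ℕ.≤ k) → b ≤ fromℕ (4 ℕ.* t)
        -- Here `k < 4 * t` already means `suc k ≤ 4 * t`, and the first term of the minimum gives
        -- the bound. In the other case the second term gives 2 t.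
        cases (no  4t≰k) = ℚ.≤-trans b≤1+k (fromℕ-mono-≤ (ℕ.≰⇒> 4t≰k))
        cases (yes 4t≤k) = ℚ.≤-trans (b≤2t 4t≤k) (fromℕ-mono-≤ (ℕ.*-monoˡ-≤ t {2} {4} (ℕ.m≤m+n 2 2)))

    min≤4t : ∀ {b} → 0ℚ < b → lower (real ((ι⁺ n 1≤n *⁺ lg⁺ x 1<x) ÷⁺ ι⁺ w 1≤w)) b →
             lower (real (lg⁺ x 1<x ÷⁺ lg⁺ ρ 1<ρ)) b → b ≤ fromℕ (4 ℕ.* t)
    min≤4t = conclude (threshold D queryTime 1≤n n<u)
      where
      conclude : (∃ λ k → u ℕ.^ n ℕ.≤ 2 ℕ.^ (suc k ℕ.* w) ℕ.* n ℕ.^ n ×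
                 (4 ℕ.* t ℕ.≤ k → u ℕ.* suc k ℕ.^ t ℕ.≤ n ℕ.* (2 ℕ.* s) ℕ.^ t)) →
                 ∀ {b} → 0ℚ < b → lower (real ((ι⁺ n 1≤n *⁺ lg⁺ x 1<x) ÷⁺ ι⁺ w 1≤w)) b →
                 lower (real (lg⁺ x 1<x ÷⁺ lg⁺ ρ 1<ρ)) b → b ≤ fromℕ (4 ℕ.* t)
      conclude (k , uⁿ≤ , dense) {b} = Threshold.min≤4t k uⁿ≤ dense {b}

open import Data.Nat.Base using (ℕ; _≤_; _<_)
open import Data.Nat.Properties using (m<n⇒0<n)
open import Data.Product.Base using (∃; Σ-syntax; _,_)
open import Defs

-- The first component makes `lg⁺` applicable to `sw/[n·lg[u/n]]`: the existence of the dictionary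
-- forces this ratio to be at least 2.
theorem2 :
  ∃ λ (c : ℝ⁺) →
  ∀ (n u s w t : ℕ) (1≤n : 1 ≤ n) (n<u : n < u) (1≤s : 1 ≤ s) (1≤w : 1 ≤ w) →
  (D : NonAdaptiveDictionary n u s w) →
  NonAdaptiveDictionary.QueryTime≤ D t →
  let n⁺ = ι⁺ n 1≤n
      u⁺ = ι⁺ u (m<n⇒0<n n<u)
      s⁺ = ι⁺ s 1≤s
      w⁺ = ι⁺ w 1≤w
      lg[u/n] = lg⁺ (u⁺ ÷⁺ n⁺) (1<m÷n (m<n⇒0<n n<u) 1≤n n<u)
      sw/[n·lg[u/n]] = (s⁺ *⁺ w⁺) ÷⁺ (n⁺ *⁺ lg[u/n])
  in Σ[ 1<r ∈ 1⁺ <⁺ sw/[n·lg[u/n]] ]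
     ℝ⁺.real (c *⁺ min⁺ ((n⁺ *⁺ lg[u/n]) ÷⁺ w⁺) (lg[u/n] ÷⁺ lg⁺ sw/[n·lg[u/n]] 1<r)) ≤ℝ ι t
theorem2 = Logarithms.¼⁺ , λ n u s w t 1≤n n<u 1≤s 1≤w D queryTime →
  let 0<u     = m<n⇒0<n n<u
      x       = ι⁺ u 0<u ÷⁺ ι⁺ n 1≤n
      1<x     = 1<m÷n 0<u 1≤n n<u
      x≤u/n   = λ {r} → Logarithms.u/n-lower 0<u 1≤n {r}
      ρ       = (ι⁺ s 1≤s *⁺ ι⁺ w 1≤w) ÷⁺ (ι⁺ n 1≤n *⁺ lg⁺ x 1<x)
      ρ-bound = Logarithms.Ratio.ρ-bound 1≤n x 1<x x≤u/n 1≤s 1≤w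
  in Logarithms.Bound.1<ρ 1≤n n<u 1≤s 1≤w D queryTime x 1<x x≤u/n ρ ρ-bound ,
     -- A rational in the lower cut of the product is less than `a * b` for some `a` below the
     -- constant and some positive `b` below both terms of the minimum.
     λ { q (a , b , 0<a , 0<b , a<¼ , (b<A , b<B) , q<ab) → Logarithms.quarter q a b t q<ab a<¼ 0<b
         (Logarithms.Bound.min≤4t 1≤n n<u 1≤s 1≤w D queryTime x 1<x x≤u/n ρ ρ-bound {b} 0<b b<A b<B) }
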